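{- Let $m,n$ be positive integers and let $T_n$ be a tree with $n$ vertices such that $\Delta(T_n)\leq n-3$ and $T_n$ is not isomorphic to $T(p,n-3-p)$ for any integer $p\geq1$. If $m+n-3$ is not a linear combination of $n-1$ and $n-2$, then $R(T_n,K_{1,m})\leq m+n-3$.
   Context: $K_{1,m}$ is the star with $m+1$ vertices. For graphs $G,H$, the Ramsey number $R(G,H)$ is the smallest integer $N$ such that every red-blue colouring of the edges of $K_N$ contains a red copy of $G$ or a blue copy of $H$. A non-negative integer $N$ is a linear combination of positive integers $p_1,\dots,p_r$ if $N=\sum_i k_ip_i$ for some non-negative integers $k_i$. For positive integers $p,q$, $T(p,q)$ denotes the tree consisting of a vertex $v_3$ adjacent to exactly two vertices $v_2,v_4$, where $v_2$ has $p$ further neighbours that are leaves and $v_4$ has $q$ further neighbours that are leaves (equivalently, a tree with a longest path $v_1v_2v_3v_4v_5$, $d(v_3)=2$, $v_2$ and $v_4$ having $p$ and $q$ leaves respectively). -}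

module Defs where

open import Data.Nat using (ℕ; zero; suc; _+_; _*_; _∸_; _≤_; _<ᵇ_; _≤ᵇ_; _≡ᵇ_)
open import Data.Fin using (Fin; toℕ; inject₁; fromℕ) renaming (zero to fzero; suc to fsuc)
open import Data.Bool using (Bool; true; false; _∧_; _∨_; if_then_else_)
open import Data.List using (List; map; allFin)
open import Data.Nat.ListAction using (sum)
open import Data.Product using (Σ; ∃; _×_; _,_)
open import Relation.Binary.PropositionalEquality using (_≡_; refl; cong)
open import Data.Sum using (_⊎_)
open import Data.Bool.Properties using (∨-comm)
open import Relation.Nullary using (¬_)
open import Function.Definitions using (Injective)
open import Function.Bundles using (_↔_; Inverse)

record Graph (n : ℕ) : Set where
  field
    adj   : Fin n → Fin n → Bool
    sym   : ∀ i j → adj i j ≡ adj j i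
    irrefl : ∀ i → adj i i ≡ false
open Graph public

data Walk {n : ℕ} (G : Graph n) : Fin n → Fin n → Set where
  []  : ∀ {u} → Walk G u u
  _∷_ : ∀ {u w v} → adj G u w ≡ true → Walk G w v → Walk G u v

Connected : ∀ {n} → Graph n → Set
Connected {n} G = ∀ (u v : Fin n) → Walk G u v

record Cycle {n : ℕ} (G : Graph n) : Set where
  field
    len   : ℕ
    vert  : Fin (suc (suc (suc len))) → Fin n
    inj   : Injective _≡_ _≡_ vert
    step  : ∀ (i : Fin (suc (suc len))) → adj G (vert (inject₁ i)) (vert (fsuc i)) ≡ true
    close : adj G (vert (fromℕ (suc (suc len)))) (vert fzero) ≡ true

Acyclic : ∀ {n} → Graph n → Set
Acyclic G = ¬ Cycle G

IsTree : ∀ {n} → Graph n → Set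
IsTree G = Connected G × Acyclic G

deg : ∀ {n} → Graph n → Fin n → ℕ
deg {n} G v = sum (map (λ j → if adj G v j then 1 else 0) (allFin n))

Iso : ∀ {a b} → Graph a → Graph b → Set
Iso {a} {b} G H = Σ (Fin a ↔ Fin b) λ f →
  ∀ i j → adj H (Inverse.to f i) (Inverse.to f j) ≡ adj G i j

starAdj : ∀ {m} → Fin (suc m) → Fin (suc m) → Bool
starAdj fzero    fzero    = false
starAdj fzero    (fsuc _) = true
starAdj (fsuc _) fzero    = true
starAdj (fsuc _) (fsuc _) = false

star : (m : ℕ) → Graph (suc m)
star m = record { adj = starAdj ; sym = s ; irrefl = r }
  where
  s : ∀ i j → starAdj i j ≡ starAdj j i
  s fzero    fzero    = refl
  s fzero    (fsuc _) = refl
  s (fsuc _) fzero    = refl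
  s (fsuc _) (fsuc _) = refl
  r : ∀ i → starAdj i i ≡ false
  r fzero    = refl
  r (fsuc _) = refl

-- The tree T(p,q) on Fin (p + q + 3):
-- 0 = v3, 1 = v2, 2 = v4, vertices 3 .. p+2 are the p leaves at v2,
-- vertices p+3 .. p+q+2 are the q leaves at v4.
Tedge : ℕ → ℕ → ℕ → Bool
Tedge p i j =
     ((i ≡ᵇ 0) ∧ ((j ≡ᵇ 1) ∨ (j ≡ᵇ 2)))
  ∨ (((i ≡ᵇ 1) ∧ ((3 ≤ᵇ j) ∧ (j <ᵇ 3 + p)))
  ∨ ((i ≡ᵇ 2) ∧ (3 + p ≤ᵇ j)))

Tedge-irrefl : ∀ p k → Tedge p k k ≡ false
Tedge-irrefl p 0 = refl
Tedge-irrefl p 1 = refl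
Tedge-irrefl p 2 = refl
Tedge-irrefl p (suc (suc (suc k))) = refl

T : (p q : ℕ) → Graph (p + q + 3)
T p q = record
  { adj = λ i j → Tedge p (toℕ i) (toℕ j) ∨ Tedge p (toℕ j) (toℕ i)
  ; sym = λ i j → ∨-comm (Tedge p (toℕ i) (toℕ j)) (Tedge p (toℕ j) (toℕ i))
  ; irrefl = λ i → cong (λ b → b ∨ b) (Tedge-irrefl p (toℕ i))
  }

-- Red/blue colourings of the edges of K_N (only values on i ≢ j matter).
data Colour : Set where
  red blue : Colour

record Colouring (N : ℕ) : Set where
  field
    col : Fin N → Fin N → Colour
    col-sym : ∀ i j → col i j ≡ col j i
open Colouring public

Copy : ∀ {k N} → Colour → Graph k → Colouring N → Set
Copy {k} {N} c G χ = Σ (Fin k → Fin N) λ f →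
  Injective _≡_ _≡_ f × (∀ i j → adj G i j ≡ true → col χ (f i) (f j) ≡ c)

-- N arrows (G, H): every red/blue colouring of K_N has a red G or a blue H.
-- R(G,H) ≤ N holds iff N arrows (G,H) (Ramsey property is monotone in N).
RamseyLE : ∀ {a b} → Graph a → Graph b → ℕ → Set
RamseyLE G H N = ∀ (χ : Colouring N) → Copy red G χ ⊎ Copy blue H χ

LinComb2 : ℕ → ℕ → ℕ → Set
LinComb2 N p q = ∃ λ (k : ℕ) → ∃ λ (l : ℕ) → k * p + l * q ≡ N

{-# OPTIONS --safe #-}
-- If there is no blue K_{1,m}, every red degree is at least n − 3. As m + n − 3 is not a
-- combination of n − 1 and n − 2, some red component has at least n vertices, so every set of
-- fewer than n vertices meeting it has an edge leaving it.
--
-- The tree has a vertex u with two leaves, or a pendant path v – u – x with deg u = 2. Root it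
-- at u (resp. v) and set the two leaves (resp. u and x) aside. A greedy embedding of the other
-- n − 2 vertices always exists; it leaves two free neighbours at the image a of the root
-- if the excess of deg a over n − 3 plus the number of non-neighbours of a in use is at least 2.
-- In the first case this places both leaves. In the second, either one of the two free
-- neighbours extends further to x, or both are joined to all used vertices but one, and
-- exchanging vertices succeeds unless the tree is T(1,q).
--
-- A component with a vertex of degree above n − 3 allows such a start at that vertex. In an
-- (n − 3)-regular component one finds an edge a – b where b has two neighbours outside N[a],
-- two disjoint edges leaving N[b] from N(b), and either a path a – b – c – d with c, d ∉ N[a]
-- or three independent vertices with common neighbours; these match the possible
-- neighbourhoods of the root, the remaining trees being T(p,q).
module Submission where

open import Defs
open import Data.Bool.Base using (Bool; true; false; _∨_; if_then_else_)
open import Data.Bool.Properties using (∨-comm; ¬-not) renaming (_≟_ to _≟ᵇ_)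
open import Data.Empty using (⊥; ⊥-elim)
open import Data.Fin.Base using (Fin; toℕ; inject₁; inject≤; fromℕ; fromℕ<; cast) renaming (zero to fzero; suc to fsuc)
open import Data.Fin.Properties using (_≟_; any?; toℕ-cast; cast-involutive; inject≤-injective)
open import Data.List.Base using (List; []; _∷_; _++_; length; map; filter; lookup; allFin)
open import Data.List.Membership.Propositional using (_∈_; _∉_; find)
import Data.List.Membership.DecPropositional as DecMembership
open import Data.List.Membership.Propositional.Properties
  using (∈-filter⁺; ∈-filter⁻; ∈-allFin; ∈-∃++; ∈-++⁺ˡ; ∈-++⁺ʳ; ∈-++⁻; ∈-map⁺; ∈-map⁻; ∈-lookup)
open import Data.List.Properties using (length-++; length-map; length-tabulate)
open import Data.List.Relation.Unary.All as All using (All; []; _∷_)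
open import Data.List.Relation.Unary.All.Properties using (¬Any⇒All¬; ¬All⇒Any¬)
open import Data.List.Relation.Unary.AllPairs using ([]; _∷_)
open import Data.List.Relation.Unary.Any as Any using (here; there)
open import Data.List.Relation.Unary.Any.Properties using (lookup-index)
open import Data.List.Relation.Unary.Unique.Propositional using (Unique)
import Data.List.Relation.Unary.Unique.Propositional.Properties as Unique
open import Data.Nat.Base
open import Data.Nat.ListAction using (sum)
open import Data.Nat.Properties hiding (_≟_)
open import Data.Product using (Σ; ∃; _×_; _,_; proj₁; proj₂)
open import Data.Sum using (_⊎_; inj₁; inj₂)
open import Function.Base using (_∘_; id; case_of_)
open import Function.Bundles using (mk↔ₛ′)
open import Relation.Binary.PropositionalEquality renaming (sym to ≡-sym)
open import Relation.Nullary using (¬_; Dec; yes; no; contradiction)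
open import Relation.Nullary.Decidable using (_×-dec_; _→-dec_; ¬?; decidable-stable)

private variable
  A : Set
  k N n : ℕ

-- Duplicate-free lists and the pigeonhole principle

infixr 5 _∷ᵘ_ _∷∉_

_∷ᵘ_ : {x : A} {xs : List A} → x ∉ xs → Unique xs → Unique (x ∷ xs)
x∉xs ∷ᵘ u = ¬Any⇒All¬ _ x∉xs ∷ u

_∷∉_ : {x y : A} {ys : List A} → x ≢ y → x ∉ ys → x ∉ y ∷ ys
(x≢y ∷∉ x∉ys) (here x≡y) = x≢y x≡y
(x≢y ∷∉ x∉ys) (there x∈ys) = x∉ys x∈ys

∉[] : {x : A} → x ∉ []
∉[] ()

∉⇒≢ : {x y : A} {ys : List A} → x ∉ ys → y ∈ ys → x ≢ y
∉⇒≢ x∉ys y∈ys refl = x∉ys y∈ys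

lookup-injective : {xs : List A} → Unique xs → ∀ {i j} → lookup xs i ≡ lookup xs j → i ≡ j
lookup-injective (_ ∷ _) {fzero} {fzero} _ = refl
lookup-injective {xs = x ∷ xs} u@(_ ∷ _) {fzero} {fsuc j} eq =
  contradiction (subst (_∈ xs) (≡-sym eq) (∈-lookup j)) (Unique.Unique[x∷xs]⇒x∉xs u)
lookup-injective {xs = x ∷ xs} u@(_ ∷ _) {fsuc i} {fzero} eq =
  contradiction (subst (_∈ xs) eq (∈-lookup i)) (Unique.Unique[x∷xs]⇒x∉xs u)
lookup-injective (_ ∷ u) {fsuc i} {fsuc j} eq = cong fsuc (lookup-injective u eq)

unique-⊆⇒length-≤ : {xs ys : List A} → Unique xs → (∀ {z} → z ∈ xs → z ∈ ys) → length xs ≤ length ys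
unique-⊆⇒length-≤ {xs = []} _ _ = z≤n
unique-⊆⇒length-≤ {xs = x ∷ xs} {ys} u@(_ ∷ u′) sub with ∈-∃++ (sub (here refl))
... | as , bs , refl = subst (suc (length xs) ≤_) (≡-sym eq) (s≤s (unique-⊆⇒length-≤ u′ sub′))
  where
  eq : length (as ++ x ∷ bs) ≡ suc (length (as ++ bs))
  eq = trans (length-++ as) (trans (+-suc (length as) (length bs)) (cong suc (≡-sym (length-++ as))))
  sub′ : ∀ {z} → z ∈ xs → z ∈ as ++ bs
  sub′ z∈xs with ∈-++⁻ as (sub (there z∈xs))
  ... | inj₁ z∈as = ∈-++⁺ˡ z∈as
  ... | inj₂ (here refl) = contradiction z∈xs (Unique.Unique[x∷xs]⇒x∉xs u)
  ... | inj₂ (there z∈bs) = ∈-++⁺ʳ as z∈bs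

_∈?_ : (i : Fin k) (U : List (Fin k)) → Dec (i ∈ U)
_∈?_ = DecMembership._∈?_ _≟_

pigeonhole : {xs ys : List (Fin k)} → Unique xs → length ys < length xs → ∃ λ z → z ∈ xs × z ∉ ys
pigeonhole {xs = xs} {ys} u lt with any? (λ z → (z ∈? xs) ×-dec ¬? (z ∈? ys))
... | yes p = p
... | no ¬p = contradiction (unique-⊆⇒length-≤ u sub) (<⇒≱ lt)
  where
  sub : ∀ {z} → z ∈ xs → z ∈ ys
  sub {z} z∈xs = decidable-stable (z ∈? ys) λ z∉ys → ¬p (z , z∈xs , z∉ys)

allFin-length : ∀ k → length (allFin k) ≡ k
allFin-length k = length-tabulate {n = k} id

unique-length : {xs : List (Fin k)} → Unique xs → length xs ≤ k
unique-length {k} {xs} u = subst (length xs ≤_) (allFin-length k) (unique-⊆⇒length-≤ u λ _ → ∈-allFin _)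

missing : (ys : List (Fin k)) → length ys < k → ∃ λ z → z ∉ ys
missing {k} ys lt =
  let z , _ , z∉ys = pigeonhole (Unique.allFin⁺ k) (subst (length ys <_) (≡-sym (allFin-length k)) lt)
  in z , z∉ys

full? : (U : List (Fin k)) → (∀ z → z ∈ U) ⊎ ∃ λ z → z ∉ U
full? U with any? (λ z → ¬? (z ∈? U))
... | yes p = inj₂ p
... | no ¬p = inj₁ λ z → decidable-stable (z ∈? U) λ z∉U → ¬p (z , z∉U)

-- Neighbourhoods and edges leaving a vertex set

Adj : Graph k → Fin k → Fin k → Set
Adj G u v = adj G u v ≡ true

module _ (G : Graph k) where

  adj? : ∀ u v → Dec (Adj G u v)
  adj? u v = adj G u v ≟ᵇ true

  nbrs : Fin k → List (Fin k)
  nbrs v = filter (adj? v) (allFin k)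

  Exit : List (Fin k) → Set
  Exit U = ∃ λ w → ∃ λ z → w ∈ U × z ∉ U × Adj G w z

module _ (G : Graph k) where

  Adj-sym : ∀ {u v} → Adj G u v → Adj G v u
  Adj-sym {u} {v} = trans (Graph.sym G v u)

  Adj-irrefl : ∀ {u} → ¬ Adj G u u
  Adj-irrefl {u} uu with trans (≡-sym uu) (irrefl G u)
  ... | ()

  Adj⇒≢ : ∀ {u v} → Adj G u v → u ≢ v
  Adj⇒≢ uv refl = Adj-irrefl uv

  nbrs⁺ : ∀ {u v} → Adj G u v → v ∈ nbrs G u
  nbrs⁺ {u} {v} = ∈-filter⁺ (adj? G u) (∈-allFin v)

  nbrs⁻ : ∀ {u v} → v ∈ nbrs G u → Adj G u v
  nbrs⁻ {u} v∈ = proj₂ (∈-filter⁻ (adj? G u) {xs = allFin k} v∈)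

  nbrs-unique : ∀ u → Unique (nbrs G u)
  nbrs-unique u = Unique.filter⁺ (adj? G u) (Unique.allFin⁺ k)

  ∉-nbrs : ∀ {u} → u ∉ nbrs G u
  ∉-nbrs = Adj-irrefl ∘ nbrs⁻

  closed-nbrs-unique : ∀ u → Unique (u ∷ nbrs G u)
  closed-nbrs-unique u = ∉-nbrs ∷ᵘ nbrs-unique u

  deg≡length-nbrs : ∀ v → deg G v ≡ length (nbrs G v)
  deg≡length-nbrs v = go (allFin k)
    where
    go : ∀ xs → sum (map (λ j → if adj G v j then 1 else 0) xs) ≡ length (filter (adj? G v) xs)
    go [] = refl
    go (x ∷ xs) with adj G v x
    ... | true = cong suc (go xs)
    ... | false = go xs

  walk-exit : ∀ {U u v} → Walk G u v → u ∈ U → v ∉ U → Exit G U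
  walk-exit [] u∈U v∉U = contradiction u∈U v∉U
  walk-exit {U} (_∷_ {w = w} uw p) u∈U v∉U with w ∈? U
  ... | yes w∈U = walk-exit p w∈U v∉U
  ... | no w∉U = _ , _ , u∈U , w∉U , uw

  connected-exit : Connected G → ∀ {u} U → u ∈ U → (∀ z → z ∈ U) ⊎ Exit G U
  connected-exit conn U u∈U with full? U
  ... | inj₁ all = inj₁ all
  ... | inj₂ (z , z∉U) = inj₂ (walk-exit (conn _ z) u∈U z∉U)

-- Subtrees

  -- Connectedness of a vertex set as a growth order, newest vertex first. It serves both for the
  -- explored part of a tree and for red components.
  data Built : List (Fin k) → Set where
    root : ∀ p → Built (p ∷ [])
    grow : ∀ {L p t} → Built L → p ∈ L → Adj G t p → t ∉ L → Built (t ∷ L)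

  Built-unique : ∀ {L} → Built L → Unique L
  Built-unique (root p) = [] ∷ []
  Built-unique (grow b _ _ t∉L) = t∉L ∷ᵘ Built-unique b

  -- The vertex list is part of the type because `Cycle` asks for an injective sequence of vertices.
  data Path : Fin k → List (Fin k) → Fin k → Set where
    stop : ∀ {p} → Path p (p ∷ []) p
    step : ∀ {p r q xs} → Adj G p r → p ∉ xs → Path r xs q → Path p (p ∷ xs) q

  Path-snoc : ∀ {p xs q r} → Path p xs q → Adj G q r → r ∉ xs → Path p (xs ++ r ∷ []) r
  Path-snoc stop qr r∉ = step qr ((λ { refl → r∉ (here refl) }) ∷∉ ∉[]) stop
  Path-snoc (step {xs = xs} pr p∉ π) qr r∉ = step pr p∉′ (Path-snoc π qr (r∉ ∘ there))
    where
    p∉′ : _ ∉ xs ++ _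
    p∉′ p∈ with ∈-++⁻ xs p∈
    ... | inj₁ p∈xs = p∉ p∈xs
    ... | inj₂ (here refl) = r∉ (here refl)

  Built-path : ∀ {L} → Built L → ∀ {p q} → p ∈ L → q ∈ L →
    ∃ λ xs → Path p xs q × (∀ {z} → z ∈ xs → z ∈ L)
  Built-path _ (here refl) (here refl) = _ , stop , λ { (here refl) → here refl }
  Built-path (grow b p₀∈ tp t∉) (here refl) (there q∈) =
    let xs , π , sub = Built-path b p₀∈ q∈
    in _ , step tp (t∉ ∘ sub) π , λ { (here refl) → here refl ; (there z∈) → there (sub z∈) }
  Built-path (grow b p₀∈ tp t∉) (there p∈) (here refl) =
    let xs , π , sub = Built-path b p∈ p₀∈
    in _ , Path-snoc π (Adj-sym tp) (t∉ ∘ sub)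
         , λ z∈ → case ∈-++⁻ xs z∈ of λ { (inj₁ z∈xs) → there (sub z∈xs) ; (inj₂ (here refl)) → here refl }
  Built-path (grow b _ _ _) (there p∈) (there q∈) =
    let xs , π , sub = Built-path b p∈ q∈ in xs , π , there ∘ sub

  Path-unique : ∀ {p xs q} → Path p xs q → Unique xs
  Path-unique stop = [] ∷ []
  Path-unique (step _ p∉ π) = p∉ ∷ᵘ Path-unique π

  Path-step : ∀ {p x xs q} → Path p (x ∷ xs) q → ∀ i → Adj G (lookup (x ∷ xs) (inject₁ i)) (lookup (x ∷ xs) (fsuc i))
  Path-step (step pr _ stop) fzero = pr
  Path-step (step pr _ (step _ _ _)) fzero = pr
  Path-step (step _ _ π@(step _ _ _)) (fsuc i) = Path-step π i

  Path-last : ∀ {p x xs q} → Path p (x ∷ xs) q → lookup (x ∷ xs) (fromℕ (length xs)) ≡ q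
  Path-last stop = refl
  Path-last (step _ _ stop) = refl
  Path-last (step _ _ π@(step _ _ _)) = Path-last π

  -- Two such neighbours would close a path inside L to a cycle.
  unique-parent : Acyclic G → ∀ {L} → Built L → ∀ {t p q} → t ∉ L → p ∈ L → q ∈ L → Adj G t p → Adj G t q → p ≡ q
  unique-parent acyclic b {t} {p} {q} t∉ p∈ q∈ tp tq with Built-path b p∈ q∈
  ... | _ , stop , _ = refl
  ... | _ , π@(step {xs = r ∷ zs} _ _ _) , sub = ⊥-elim (acyclic cycle)
    where
    τ : Path t (t ∷ p ∷ r ∷ zs) q
    τ = step tp (t∉ ∘ sub) π
    cycle : Cycle G
    cycle = record
      { len = length zs
      ; vert = lookup (t ∷ p ∷ r ∷ zs)
      ; inj = lookup-injective (Path-unique τ)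
      ; step = Path-step τ
      ; close = subst (λ z → Adj G z t) (≡-sym (Path-last τ)) (Adj-sym tq)
      }

-- Partial embeddings

Embedding : Graph n → Graph N → Set
Embedding {n} {N} G H = Σ (Fin n → Fin N) λ f →
  (∀ {i j} → f i ≡ f j → i ≡ j) × (∀ {i j} → Adj G i j → Adj H (f i) (f j))

dom : List (Fin n × Fin N) → List (Fin n)
dom = map proj₁

cod : List (Fin n × Fin N) → List (Fin N)
cod = map proj₂

∈-dom : ∀ {L : List (Fin n × Fin N)} {t h} → (t , h) ∈ L → t ∈ dom L
∈-dom = ∈-map⁺ proj₁

∈-cod : ∀ {L : List (Fin n × Fin N)} {t h} → (t , h) ∈ L → h ∈ cod L
∈-cod = ∈-map⁺ proj₂

dom-entry : ∀ {L : List (Fin n × Fin N)} {t} → t ∈ dom L → ∃ λ h → (t , h) ∈ L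
dom-entry t∈ with ∈-map⁻ proj₁ t∈
... | (_ , h) , th∈ , refl = h , th∈

cod-entry : ∀ {L : List (Fin n × Fin N)} {h} → h ∈ cod L → ∃ λ t → (t , h) ∈ L
cod-entry h∈ with ∈-map⁻ proj₂ h∈
... | (t , _) , th∈ , refl = t , th∈

module PartialEmbeddings {n N : ℕ} (G : Graph n) (H : Graph N) (tree : IsTree G) where

  Pairs : Set
  Pairs = List (Fin n × Fin N)

  -- A finite relation with no condition of connectedness, so that pairs can be taken out and
  -- replaced, as `swap` does; `Partial` adds a connected domain.
  record IsPartial (L : Pairs) : Set where
    field
      functional : ∀ {t h h′} → (t , h) ∈ L → (t , h′) ∈ L → h ≡ h′
      injective  : ∀ {t t′ h} → (t , h) ∈ L → (t′ , h) ∈ L → t ≡ t′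
      preserves  : ∀ {t t′ h h′} → (t , h) ∈ L → (t′ , h′) ∈ L → Adj G t t′ → Adj H h h′
  open IsPartial public

  partial-⊆ : ∀ {L L′} → (∀ {p} → p ∈ L → p ∈ L′) → IsPartial L′ → IsPartial L
  partial-⊆ sub P = record
    { functional = λ a b → functional P (sub a) (sub b)
    ; injective = λ a b → injective P (sub a) (sub b)
    ; preserves = λ a b → preserves P (sub a) (sub b)
    }

  partial-∷ : ∀ {L t h} → IsPartial L → t ∉ dom L → h ∉ cod L →
    (∀ {s k} → (s , k) ∈ L → Adj G t s → Adj H h k) → IsPartial ((t , h) ∷ L)
  partial-∷ {L} {t} {h} P t∉ h∉ hom = record { functional = f ; injective = i ; preserves = p }
    where
    f : ∀ {s k k′} → (s , k) ∈ (t , h) ∷ L → (s , k′) ∈ (t , h) ∷ L → k ≡ k′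
    f (here refl) (here refl) = refl
    f (here refl) (there b) = contradiction (∈-dom b) t∉
    f (there a) (here refl) = contradiction (∈-dom a) t∉
    f (there a) (there b) = functional P a b
    i : ∀ {s s′ k} → (s , k) ∈ (t , h) ∷ L → (s′ , k) ∈ (t , h) ∷ L → s ≡ s′
    i (here refl) (here refl) = refl
    i (here refl) (there b) = contradiction (∈-cod b) h∉
    i (there a) (here refl) = contradiction (∈-cod a) h∉
    i (there a) (there b) = injective P a b
    p : ∀ {s s′ k k′} → (s , k) ∈ (t , h) ∷ L → (s′ , k′) ∈ (t , h) ∷ L → Adj G s s′ → Adj H k k′
    p (here refl) (here refl) ss = contradiction ss (Adj-irrefl G)
    p (here refl) (there b) ss = hom b ss
    p (there a) (here refl) ss = Adj-sym H (hom a (Adj-sym G ss))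
    p (there a) (there b) ss = preserves P a b ss

  embedding : ∀ {L} → IsPartial L → (∀ t → t ∈ dom L) → Embedding G H
  embedding {L} P total = f , inj , λ {i} {j} → preserves P (entry i) (entry j)
    where
    f : Fin n → Fin N
    f t = proj₁ (dom-entry (total t))
    entry : ∀ t → (t , f t) ∈ L
    entry t = proj₂ (dom-entry (total t))
    inj : ∀ {i j} → f i ≡ f j → i ≡ j
    inj {i} {j} eq = injective P (entry i) (subst (λ h → (j , h) ∈ L) (≡-sym eq) (entry j))

  record Partial (L : Pairs) : Set where
    constructor partial
    field
      built : Built G (dom L)
      isPartial : IsPartial L
  open Partial public

  start : ∀ t h → Partial ((t , h) ∷ [])
  start t h = partial (root t) (partial-∷ (record { functional = λ () ; injective = λ () ; preserves = λ () }) ∉[] ∉[] λ ())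

  -- In a tree, t has no neighbour but p in the connected domain, so h - k is the only edge that the
  -- host must provide.
  attach : ∀ {L p h t k} → Partial L → (p , h) ∈ L → Adj G p t → t ∉ dom L → Adj H h k → k ∉ cod L →
    Partial ((t , k) ∷ L)
  attach {L} {p} {h} {t} {k} (partial b P) ph∈ pt t∉ hk k∉ =
    partial (grow b (∈-dom ph∈) (Adj-sym G pt) t∉) (partial-∷ P t∉ k∉ hom)
    where
    hom : ∀ {s m} → (s , m) ∈ L → Adj G t s → Adj H k m
    hom sm∈ ts with unique-parent G (proj₂ tree) b t∉ (∈-dom sm∈) (∈-dom ph∈) ts (Adj-sym G pt)
    ... | refl with functional P sm∈ ph∈
    ... | refl = Adj-sym H hk

  -- The vertices of C (usually including h itself) occupy places of L without blocking
  -- neighbours of h, so h has a free neighbour as long as L has fewer than s vertices.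
  record Room (s : ℕ) (h : Fin N) (L : Pairs) : Set where
    constructor room
    field
      {C} : List (Fin N)
      C-unique : Unique C
      C-used : ∀ {c} → c ∈ C → c ∈ cod L
      C-nonadjacent : ∀ {c} → c ∈ C → ¬ Adj H h c
      C-length : s ≤ length C + length (nbrs H h)

  room-⊆ : ∀ {s h L L′} → (∀ {p} → p ∈ L → p ∈ L′) → Room s h L → Room s h L′
  room-⊆ sub (room u used non len) = room u (λ c∈ → ∈-cod (sub (proj₂ (cod-entry (used c∈))))) non len

  free-neighbour : ∀ {s h L} → Room s h L → length L < s → ∃ λ k → Adj H h k × k ∉ cod L
  free-neighbour {s} {h} {L} (room {C} u used non len) lt
    with pigeonhole {ys = cod L}
      (Unique.++⁺ u (nbrs-unique H h) λ (c∈ , k∈) → non c∈ (nbrs⁻ H k∈))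
      (≤-trans (s≤s (≤-reflexive (length-map proj₂ L))) (≤-trans lt (≤-trans len (≤-reflexive (≡-sym (length-++ C))))))
  ... | k , k∈ , k∉ with ∈-++⁻ C k∈
  ... | inj₁ k∈C = contradiction (used k∈C) k∉
  ... | inj₂ k∈N = k , nbrs⁻ H k∈N , k∉

  length-dom-< : ∀ {L t} → Partial L → t ∉ dom L → length L < n
  length-dom-< {L} {t} P t∉ =
    subst (λ l → suc l ≤ n) (length-map proj₁ L) (unique-length (t∉ ∷ᵘ Built-unique G (built P)))

  -- Room for n lasts to the end: until the whole tree is placed, L has fewer than n pairs.
  Ready : Fin N → Pairs → Set
  Ready = Room n

  -- Readiness survives enlarging L, so the missing vertices, each hanging from a placed one with a
  -- ready image, can be added one at a time. `fuel` bounds how many are missing.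
  finish : ∀ {L} → Partial L →
    (∀ t → t ∉ dom L → ∃ λ p → ∃ λ h → (p , h) ∈ L × Adj G p t × Ready h L) → Embedding G H
  finish {L} P rest = go n P rest (m≤n+m n (length L))
    where
    go : ∀ fuel {L} → Partial L →
      (∀ t → t ∉ dom L → ∃ λ p → ∃ λ h → (p , h) ∈ L × Adj G p t × Ready h L) → n ≤ length L + fuel → Embedding G H
    go fuel {L} P rest le with full? (dom L)
    ... | inj₁ full = embedding (isPartial P) full
    go zero {L} P rest le | inj₂ (t , t∉) =
      contradiction (length-dom-< P t∉) (≤⇒≯ (subst (n ≤_) (+-identityʳ _) le))
    go (suc fuel) {L} P rest le | inj₂ (t , t∉) =
      let p , h , ph∈ , pt , ready = rest t t∉
          k , hk , k∉ = free-neighbour ready (length-dom-< P t∉)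
      in go fuel (attach P ph∈ pt t∉ hk k∉)
           (λ t′ t′∉ → let p′ , h′ , ph′∈ , pt′ , ready′ = rest t′ (t′∉ ∘ there)
                       in p′ , h′ , there ph′∈ , pt′ , room-⊆ there ready′)
           (subst (n ≤_) (+-suc _ fuel) le)

  module _ (mindeg : ∀ h → n ≤ 3 + length (nbrs H h)) where

    -- As long as some t outside Z is unplaced, t and the two vertices of Z are missing from L, so L
    -- has at most n - 3 pairs. The image h of the parent of t has at least n - 3 neighbours and is
    -- itself among the used vertices, so one neighbour is free. Since Z meets the rest only at ρ,
    -- no vertex has to be reached through Z.
    spread : ∀ {L ρ} Z → Unique Z → length Z ≡ 2 → Partial L → ρ ∈ dom L → (∀ {z} → z ∈ Z → z ∉ dom L) →
      (∀ {z w} → z ∈ Z → Adj G z w → w ∈ Z ⊎ w ≡ ρ) →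
      ∃ λ L′ → Partial L′ × (∀ {p} → p ∈ L → p ∈ L′) × (∀ {z} → z ∈ Z → z ∉ dom L′) × (∀ t → t ∈ dom L′ ⊎ t ∈ Z)
    spread {L} {ρ} Z Z-unique Z-length P ρ∈ Z∉ sealed = go n P ρ∈ Z∉ (m≤n+m n (length L))
      where
      Z∪dom-length : ∀ L → length (Z ++ dom L) ≡ 2 + length L
      Z∪dom-length L = trans (length-++ Z) (cong₂ _+_ Z-length (length-map proj₁ L))
      go : ∀ fuel {L} → Partial L → ρ ∈ dom L → (∀ {z} → z ∈ Z → z ∉ dom L) → n ≤ length L + fuel →
        ∃ λ L′ → Partial L′ × (∀ {p} → p ∈ L → p ∈ L′) × (∀ {z} → z ∈ Z → z ∉ dom L′) × (∀ t → t ∈ dom L′ ⊎ t ∈ Z)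
      go fuel {L} P ρ∈ Z∉ le with connected-exit G (proj₁ tree) (Z ++ dom L) (∈-++⁺ʳ Z ρ∈)
      ... | inj₁ full = L , P , id , Z∉ , λ t → case ∈-++⁻ Z (full t) of λ { (inj₁ z) → inj₂ z ; (inj₂ d) → inj₁ d }
      ... | inj₂ (w , t , w∈ , t∉ , wt) with ∈-++⁻ Z w∈
      ... | inj₁ w∈Z = contradiction (case sealed w∈Z wt of λ { (inj₁ t∈Z) → ∈-++⁺ˡ t∈Z ; (inj₂ refl) → ∈-++⁺ʳ Z ρ∈ }) t∉
      go zero {L} P ρ∈ Z∉ le | inj₂ (w , t , w∈ , t∉ , wt) | inj₂ w∈L =
        contradiction (length-dom-< P (t∉ ∘ ∈-++⁺ʳ Z)) (≤⇒≯ (subst (n ≤_) (+-identityʳ _) le))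
      go (suc fuel) {L} P ρ∈ Z∉ le | inj₂ (w , t , w∈ , t∉ , wt) | inj₂ w∈L =
        let h , wh∈ = dom-entry w∈L
            k , hk , k∉ = free-neighbour {suc (length (nbrs H h))} {h} {L}
              (room (∉[] ∷ᵘ []) (λ { (here refl) → ∈-cod wh∈ }) (λ { (here refl) → Adj-irrefl H }) ≤-refl)
              (s≤s⁻¹ (s≤s⁻¹ (≤-trans 3+L≤n (mindeg h))))
            L′ , P′ , sub , Z∉′ , cover = go fuel (attach P wh∈ wt (t∉ ∘ ∈-++⁺ʳ Z) hk k∉) (there ρ∈)
              (λ { z∈ (here refl) → t∉ (∈-++⁺ˡ z∈) ; z∈ (there z∈L) → Z∉ z∈ z∈L })
              (subst (n ≤_) (+-suc _ fuel) le)
        in L′ , P′ , sub ∘ there , Z∉′ , cover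
        where
        3+L≤n : 3 + length L ≤ n
        3+L≤n = subst (λ l → suc l ≤ n) (Z∪dom-length L)
          (unique-length (t∉ ∷ᵘ Unique.++⁺ Z-unique (Built-unique G (built P)) λ (a , b) → Z∉ a b))

-- Configurations in a regular host graph

Big : ℕ → Graph N → Fin N → Set
Big n H a = ∀ U → a ∈ U → length U < n → Exit H U

record InducedP₃ (H : Graph N) (a b c : Fin N) : Set where
  constructor induced
  field
    a~b : Adj H a b
    b~c : Adj H b c
    a≁c : ¬ Adj H a c
    a≢c : a ≢ c

induced-sym : ∀ (H : Graph N) {a b c} → InducedP₃ H a b c → InducedP₃ H c b a
induced-sym H (induced ab bc ac a≢c) = induced (Adj-sym H bc) (Adj-sym H ab) (ac ∘ Adj-sym H) (a≢c ∘ ≡-sym)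

-- N[a] has fewer than n vertices, so an edge leaves it, and that edge starts at a neighbour of a.
inducedP₃-from : ∀ (H : Graph N) {n a} → Big n H a → 2 + length (nbrs H a) ≤ n → ∃ λ b → ∃ λ c → InducedP₃ H a b c
inducedP₃-from H {a = a} big lt with big (a ∷ nbrs H a) (here refl) lt
... | w , z , here refl , z∉ , wz = contradiction (there (nbrs⁺ H wz)) z∉
... | w , z , there w∈ , z∉ , wz =
  w , z , induced (nbrs⁻ H w∈) wz (z∉ ∘ there ∘ nbrs⁺ H) λ { refl → z∉ (here refl) }

module RegularHost {N n : ℕ} (H : Graph N) (K : Fin N → Set) (K? : ∀ a → Dec (K a))
  (K-closed : ∀ {a b} → K a → Adj H a b → K b) (K-big : ∀ {a} → K a → Big n H a)
  (regular : ∀ {a} → K a → 3 + length (nbrs H a) ≡ n) where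

  inducedP₃ : ∀ {a} → K a → ∃ λ b → ∃ λ c → InducedP₃ H a b c
  inducedP₃ {a} Ka = inducedP₃-from H (K-big Ka) (≤-trans (n≤1+n _) (≤-reflexive (regular Ka)))

  private
    deg≡ : ∀ {a b} → K a → K b → length (nbrs H a) ≡ length (nbrs H b)
    deg≡ Ka Kb = +-cancelˡ-≡ 3 _ _ (trans (regular Ka) (≡-sym (regular Kb)))

  -- As a and b have equally many neighbours, N[a] ∖ N[b] is as large as N[b] ∖ N[a].
  exchange : ∀ {a b X} Y → K a → Adj H a b → Unique X → (∀ {x} → x ∈ X → InducedP₃ H a b x) →
    length Y < length X → ∃ λ p → InducedP₃ H b a p × p ∉ Y
  exchange {a} {b} {X} Y Ka ab uX X-ind lt
    with pigeonhole {xs = X ++ a ∷ nbrs H a} {ys = Y ++ b ∷ nbrs H b}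
      (Unique.++⁺ uX (closed-nbrs-unique H a) λ where
        (x∈ , here refl) → InducedP₃.a≢c (X-ind x∈) refl
        (x∈ , there x∈N) → InducedP₃.a≁c (X-ind x∈) (nbrs⁻ H x∈N))
      (subst₂ _<_ (≡-sym (length-++ Y)) (≡-sym (length-++ X))
        (+-mono-<-≤ lt (≤-reflexive (cong suc (deg≡ (K-closed Ka ab) Ka)))))
  ... | p , p∈ , p∉ with ∈-++⁻ X p∈
  ... | inj₁ p∈X = contradiction (∈-++⁺ʳ Y (there (nbrs⁺ H (InducedP₃.b~c (X-ind p∈X))))) p∉
  ... | inj₂ (here refl) = contradiction (∈-++⁺ʳ Y (there (nbrs⁺ H (Adj-sym H ab)))) p∉
  ... | inj₂ (there p∈N) = p
    , induced (Adj-sym H ab) (nbrs⁻ H p∈N) (p∉ ∘ ∈-++⁺ʳ Y ∘ there ∘ nbrs⁺ H) (λ { refl → p∉ (∈-++⁺ʳ Y (here refl)) })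
    , p∉ ∘ ∈-++⁺ˡ

  exchange₁ : ∀ {a b c} → K a → InducedP₃ H a b c → ∃ λ p → InducedP₃ H b a p
  exchange₁ Ka abc with exchange [] Ka (InducedP₃.a~b abc) (∉[] ∷ᵘ []) (λ { (here refl) → abc }) ≤-refl
  ... | p , bap , _ = p , bap

  Fork : Fin N → Fin N → Fin N → Fin N → Set
  Fork a b c c′ = K a × InducedP₃ H a b c × InducedP₃ H a b c′ × c ≢ c′

  private
    induced? : ∀ a b c → Dec (InducedP₃ H a b c)
    induced? a b c with adj? H a b ×-dec adj? H b c ×-dec ¬? (adj? H a c) ×-dec ¬? (a ≟ c)
    ... | yes (p , q , r , s) = yes (induced p q r s)
    ... | no ¬p = no λ { (induced p q r s) → ¬p (p , q , r , s) }

  Bifork : Fin N → Fin N → Fin N → Fin N → Fin N → Set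
  Bifork b a p c r = K b × InducedP₃ H b a p × InducedP₃ H b c r × a ≢ c × p ≢ r

  module _ (n≥6 : 6 ≤ n) where

    private
      module NoFork (¬fork : ∀ {a b c c′} → K a → InducedP₃ H a b c → InducedP₃ H a b c′ → c ≡ c′) where

        -- If d missed a, then c and d would be two neighbours of b outside N[a], a fork; the same
        -- holds with a and c exchanged.
        common : ∀ {a b c d} → K a → InducedP₃ H a b c → Adj H b d → d ≢ a → d ≢ c → Adj H d a × Adj H d c
        common {a} {b} {c} {d} Ka abc bd d≢a d≢c =
            Adj-sym H (decidable-stable (adj? H a d) λ ad → d≢c (¬fork Ka (induced (InducedP₃.a~b abc) bd ad (d≢a ∘ ≡-sym)) abc))
          , Adj-sym H (decidable-stable (adj? H c d) λ cd →
              d≢a (¬fork Kc (induced (InducedP₃.a~b cba) bd cd (d≢c ∘ ≡-sym)) cba))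
          where
          cba = induced-sym H abc
          Kc = K-closed (K-closed Ka (InducedP₃.a~b abc)) (InducedP₃.b~c abc)

        -- Writing N(b) = {a, c} ∪ D, the set {b, q} ∪ N(b) has no neighbours outside.
        absurd : ∀ {a₀} → K a₀ → ⊥
        absurd {a} Ka with inducedP₃ Ka
        ... | b , c , abc with exchange₁ Ka abc
        -- As n ≥ 6, the degree n - 3 of b is at least 3, which leaves a neighbour d besides a and
        -- c.
        ... | q , baq with pigeonhole {ys = a ∷ c ∷ []} (nbrs-unique H b)
          (+-cancelˡ-≤ 3 3 _ (≤-trans n≥6 (≤-reflexive (≡-sym (regular (K-closed Ka (InducedP₃.a~b abc)))))))
        -- U has 2 + (n - 3) = n - 1 vertices, so an edge should leave it.
        ... | d , bd , d∉ = closed (K-big Kb U (here refl) (≤-reflexive (regular Kb)))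
          where
          Kb = K-closed Ka (InducedP₃.a~b abc)
          U = b ∷ q ∷ nbrs H b
          ab = InducedP₃.a~b abc
          bc = InducedP₃.b~c abc
          aq = InducedP₃.b~c baq
          qab : InducedP₃ H q a b
          qab = induced-sym H baq
          d~a,c : Adj H d a × Adj H d c
          d~a,c = common Ka abc (nbrs⁻ H bd) (∉⇒≢ d∉ (here refl)) (∉⇒≢ d∉ (there (here refl)))
          dq : Adj H d q
          dq = proj₁ (common (K-closed Ka aq) qab (Adj-sym H (proj₁ d~a,c))
            (λ { refl → InducedP₃.a≁c baq (nbrs⁻ H bd) }) (λ { refl → ∉-nbrs H bd }))
          via : ∀ {d} → Adj H d a → Adj H d c → InducedP₃ H a d c
          via da dc = induced (Adj-sym H da) dc (InducedP₃.a≁c abc) (InducedP₃.a≢c abc)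
          qc : Adj H q c
          qc = proj₂ (common Ka (via (proj₁ d~a,c) (proj₂ d~a,c)) dq
            (Adj⇒≢ H aq ∘ ≡-sym) (λ { refl → InducedP₃.a≁c abc aq }))
          bcq : InducedP₃ H b c q
          bcq = induced bc (Adj-sym H qc) (InducedP₃.a≁c baq) (InducedP₃.a≢c baq)
          -- Apart from b, a vertex of U is a or c or is adjacent to both. The next three facts keep
          -- its neighbours inside U in each case.
          a-closed : ∀ {z} → Adj H a z → z ∈ U
          a-closed {z} az = decidable-stable (z ∈? U) λ z∉ → z∉ (there (there (nbrs⁺ H (Adj-sym H
            (proj₂ (common (K-closed Ka aq) qab az (∉⇒≢ z∉ (there (here refl))) (∉⇒≢ z∉ (here refl))))))))
          c-closed : ∀ {z} → Adj H c z → z ∈ U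
          c-closed {z} cz = decidable-stable (z ∈? U) λ z∉ → z∉ (there (there (nbrs⁺ H (Adj-sym H
            (proj₁ (common Kb bcq cz (∉⇒≢ z∉ (here refl)) (∉⇒≢ z∉ (there (here refl)))))))))
          via-closed : ∀ {w z} → Adj H w a → Adj H w c → Adj H w z → z ∈ U
          via-closed {w} {z} wa wc wz = decidable-stable (z ∈? U) λ z∉ → z∉ (a-closed (Adj-sym H
            (proj₁ (common Ka (via wa wc) wz
              (∉⇒≢ z∉ (there (there (nbrs⁺ H (Adj-sym H ab))))) (∉⇒≢ z∉ (there (there (nbrs⁺ H bc))))))))
          closed : ¬ Exit H U
          closed (_ , z , here refl , z∉ , bz) = z∉ (there (there (nbrs⁺ H bz)))
          closed (_ , z , there (here refl) , z∉ , qz) = z∉ (via-closed (Adj-sym H aq) qc qz)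
          closed (w , z , there (there w∈) , z∉ , wz) with w ≟ a | w ≟ c
          ... | yes refl | _ = z∉ (a-closed wz)
          ... | no _ | yes refl = z∉ (c-closed wz)
          ... | no w≢a | no w≢c =
            let wa , wc = common Ka abc (nbrs⁻ H w∈) w≢a w≢c in z∉ (via-closed wa wc wz)

    fork-exists : ∀ {a₀} → K a₀ → ∃ λ a → ∃ λ b → ∃ λ c → ∃ λ c′ → Fork a b c c′
    fork-exists Ka₀ with any? (λ a → any? λ b → any? λ c → any? λ c′ →
      K? a ×-dec induced? a b c ×-dec induced? a b c′ ×-dec ¬? (c ≟ c′))
    ... | yes p = p
    ... | no ¬p = ⊥-elim (NoFork.absurd (λ {a} {b} {c} {c′} Ka abc abc′ →
      decidable-stable (c ≟ c′) λ c≢c′ → ¬p (a , b , c , c′ , Ka , abc , abc′ , c≢c′)) Ka₀)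

    -- One exchange along c - b gives an edge c - r leaving N[b]. The fork puts both c and c′ into
    -- N[b] outside N[a], so the exchange along a - b can still avoid r.
    bifork-exists : ∀ {a₀} → K a₀ → ∃ λ b → ∃ λ a → ∃ λ p → ∃ λ c → ∃ λ r → Bifork b a p c r
    bifork-exists Ka₀ =
      let a , b , c , c′ , Ka , abc , abc′ , c≢c′ = fork-exists Ka₀
          Kb = K-closed Ka (InducedP₃.a~b abc)
          r , bcr = exchange₁ (K-closed Kb (InducedP₃.b~c abc)) (induced-sym H abc)
          p , bap , p∉ = exchange (r ∷ []) Ka (InducedP₃.a~b abc)
            ((c≢c′ ∷∉ ∉[]) ∷ᵘ ∉[] ∷ᵘ []) (λ { (here refl) → abc ; (there (here refl)) → abc′ }) ≤-refl
      in b , a , p , c , r , Kb , bap , bcr , InducedP₃.a≢c abc , p∉ ∘ here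

  FarPath : Fin N → Fin N → Fin N → Fin N → Set
  FarPath a b c d = K a × InducedP₃ H a b c × Adj H c d × ¬ Adj H a d × a ≢ d

  -- A path a - b - c - d - e with the chord a - d: the independent vertices a, c, e share the
  -- neighbour d, and b is a second common neighbour of a and c.
  record Zigzag (a b c d e : Fin N) : Set where
    field
      Ka : K a
      abc : InducedP₃ H a b c
      adc : InducedP₃ H a d c
      ade : InducedP₃ H a d e
      cde : InducedP₃ H c d e
      b≢d : b ≢ d

  -- Without far paths, a and all its non-neighbours have the same neighbourhood.
  far-path-or-zigzag : 5 ≤ n → ∀ {a₀} → K a₀ →
    (∃ λ a → ∃ λ b → ∃ λ c → ∃ λ d → FarPath a b c d) ⊎
    (∃ λ a → ∃ λ b → ∃ λ c → ∃ λ d → ∃ λ e → Zigzag a b c d e)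
  far-path-or-zigzag n≥5 {a} Ka with any? (λ a → any? λ b → any? λ c → any? λ d →
      K? a ×-dec induced? a b c ×-dec adj? H c d ×-dec ¬? (adj? H a d) ×-dec ¬? (a ≟ d))
  ... | yes p = inj₁ p
  ... | no ¬p = inj₂ (zigzag (inducedP₃ Ka))
    where
    twin : ∀ {a b c d} → K a → InducedP₃ H a b c → Adj H c d → Adj H a d
    twin {a} {b} {c} {d} Ka abc cd = decidable-stable (adj? H a d) λ ad →
      ¬p (a , b , c , d , Ka , abc , cd , ad , λ { refl → InducedP₃.a≁c abc (Adj-sym H cd) })
    zigzag : (∃ λ b → ∃ λ c → InducedP₃ H a b c) → ∃ λ a → ∃ λ b → ∃ λ c → ∃ λ d → ∃ λ e → Zigzag a b c d e
    -- These are n - 1 vertices. As c has no neighbour outside N(a), the leaving edge starts at a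
    -- neighbour w of a and ends at a second non-neighbour z of a.
    zigzag (b , c , abc) with K-big Ka (c ∷ a ∷ nbrs H a) (there (here refl)) (≤-reflexive (regular Ka))
    ... | w , z , here refl , z∉ , wz = contradiction (there (there (nbrs⁺ H (twin Ka abc wz)))) z∉
    ... | w , z , there (here refl) , z∉ , wz = contradiction (there (there (nbrs⁺ H wz))) z∉
    -- By n ≥ 5 there is a neighbour d of a other than b; being twins of a, both c and z are
    -- adjacent to it.
    ... | w , z , there (there w∈) , z∉ , wz with pigeonhole {ys = b ∷ []} (nbrs-unique H a)
      (+-cancelˡ-≤ 3 2 _ (≤-trans n≥5 (≤-reflexive (≡-sym (regular Ka)))))
    ... | d , d∈ , d∉ = a , b , c , d , z , record
      { Ka = Ka ; abc = abc
      ; adc = induced (nbrs⁻ H d∈) (Adj-sym H cd) (InducedP₃.a≁c abc) (InducedP₃.a≢c abc)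
      ; ade = induced (nbrs⁻ H d∈) (Adj-sym H zd) (InducedP₃.a≁c awz) (InducedP₃.a≢c awz)
      ; cde = induced cd (Adj-sym H zd) (λ cz → InducedP₃.a≁c awz (twin Ka abc cz)) (λ { refl → z∉ (here refl) })
      ; b≢d = λ { refl → d∉ (here refl) }
      }
      where
      awz : InducedP₃ H a w z
      awz = induced (nbrs⁻ H w∈) wz (z∉ ∘ there ∘ there ∘ nbrs⁺ H) λ { refl → z∉ (there (here refl)) }
      cd : Adj H c d
      cd = twin Kc (induced-sym H abc) (nbrs⁻ H d∈)
        where Kc = K-closed (K-closed Ka (InducedP₃.a~b abc)) (InducedP₃.b~c abc)
      zd : Adj H z d
      zd = twin Kz (induced-sym H awz) (nbrs⁻ H d∈)
        where Kz = K-closed (K-closed Ka (InducedP₃.a~b awz)) (InducedP₃.b~c awz)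

-- Recognising T p q

<⇒<ᵇ≡true : ∀ {m n} → m < n → (m <ᵇ n) ≡ true
<⇒<ᵇ≡true {zero} (s≤s _) = refl
<⇒<ᵇ≡true {suc m} (s≤s lt) = <⇒<ᵇ≡true lt

≥⇒<ᵇ≡false : ∀ {m n} → n ≤ m → (m <ᵇ n) ≡ false
≥⇒<ᵇ≡false {m} {zero} _ = refl
≥⇒<ᵇ≡false {suc m} (s≤s le) = ≥⇒<ᵇ≡false le

lookup-++-split : ∀ {A : Set} (xs ys : List A) (i : Fin (length (xs ++ ys))) →
  (toℕ i < length xs × lookup (xs ++ ys) i ∈ xs) ⊎ ∃ λ m → toℕ i ≡ length xs + m × lookup (xs ++ ys) i ∈ ys
lookup-++-split [] ys i = inj₂ (toℕ i , refl , ∈-lookup i)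
lookup-++-split (x ∷ xs) ys fzero = inj₁ (s≤s z≤n , here refl)
lookup-++-split (x ∷ xs) ys (fsuc i) with lookup-++-split xs ys i
... | inj₁ (lt , i∈) = inj₁ (s≤s lt , there i∈)
... | inj₂ (m , eq , i∈) = inj₂ (m , cong suc eq , i∈)

∈⇒1≤length : ∀ {A : Set} {z : A} {xs} → z ∈ xs → 1 ≤ length xs
∈⇒1≤length (here _) = s≤s z≤n
∈⇒1≤length (there _) = s≤s z≤n

-- Acyclicity forces the shape: a further vertex adjacent to two spine vertices, or two further
-- vertices adjacent to each other, would close a cycle. So they are leaves at u or at w, and the
-- tree is T(p,q) with centre v.
module Recognise {n : ℕ} (G : Graph n) (tree : IsTree G) {u v w : Fin n}
  (uv : Adj G u v) (vw : Adj G v w) (u≢w : u ≢ w)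
  (cover : ∀ z → z ∉ u ∷ v ∷ w ∷ [] → Adj G u z ⊎ Adj G w z) where

  private
    spine : List (Fin n)
    spine = w ∷ v ∷ u ∷ []

    spine-built : Built G spine
    spine-built = grow (grow (root u) (here refl) (Adj-sym G uv) (Adj⇒≢ G (Adj-sym G uv) ∷∉ ∉[]))
      (here refl) (Adj-sym G vw) (Adj⇒≢ G (Adj-sym G vw) ∷∉ u≢w ∘ ≡-sym ∷∉ ∉[])

    one-parent : ∀ {L t p q} → Built G L → t ∉ L → p ∈ L → q ∈ L → Adj G t p → Adj G t q → p ≡ q
    one-parent b = unique-parent G (proj₂ tree) b

    u≁w : ¬ Adj G u w
    u≁w uw = Adj⇒≢ G uv (one-parent
      (grow (root u) (here refl) (Adj-sym G uv) (Adj⇒≢ G (Adj-sym G uv) ∷∉ ∉[]))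
      (Adj⇒≢ G (Adj-sym G vw) ∷∉ u≢w ∘ ≡-sym ∷∉ ∉[]) (there (here refl)) (here refl) (Adj-sym G uw) (Adj-sym G vw))

    off-v : ∀ z → Dec (z ≢ v)
    off-v z = ¬? (z ≟ v)

    leaves : Fin n → List (Fin n)
    leaves x = filter off-v (nbrs G x)

    leaves⁺ : ∀ {x z} → Adj G x z → z ≢ v → z ∈ leaves x
    leaves⁺ xz = ∈-filter⁺ off-v (nbrs⁺ G xz)

    leaves⁻ : ∀ {x z} → z ∈ leaves x → Adj G x z × z ≢ v
    leaves⁻ {x} z∈ = let z∈N , z≢v = ∈-filter⁻ off-v {xs = nbrs G x} z∈ in nbrs⁻ G z∈N , z≢v

    leaves-unique : ∀ x → Unique (leaves x)
    leaves-unique x = Unique.filter⁺ off-v (nbrs-unique G x)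

    leafᵘ-off : ∀ {z} → z ∈ leaves u → z ∉ spine
    leafᵘ-off z∈ with leaves⁻ z∈
    ... | uz , z≢v = (λ { refl → u≁w uz }) ∷∉ z≢v ∷∉ Adj⇒≢ G uz ∘ ≡-sym ∷∉ ∉[]

    leafʷ-off : ∀ {z} → z ∈ leaves w → z ∉ spine
    leafʷ-off z∈ with leaves⁻ z∈
    ... | wz , z≢v = Adj⇒≢ G wz ∘ ≡-sym ∷∉ z≢v ∷∉ (λ { refl → u≁w (Adj-sym G wz) }) ∷∉ ∉[]

    leafᵘ-parent : ∀ {z x} → z ∈ leaves u → x ∈ spine → Adj G z x → u ≡ x
    leafᵘ-parent z∈ x∈ = one-parent spine-built (leafᵘ-off z∈) (there (there (here refl))) x∈ (Adj-sym G (proj₁ (leaves⁻ z∈)))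

    leafʷ-parent : ∀ {z x} → z ∈ leaves w → x ∈ spine → Adj G z x → w ≡ x
    leafʷ-parent z∈ x∈ = one-parent spine-built (leafʷ-off z∈) (here refl) x∈ (Adj-sym G (proj₁ (leaves⁻ z∈)))

    OffSpine : Fin n → Set
    OffSpine z = z ∉ spine × ∃ λ x → x ∈ spine × Adj G z x

    offᵘ : ∀ {z} → z ∈ leaves u → OffSpine z
    offᵘ z∈ = leafᵘ-off z∈ , u , there (there (here refl)) , Adj-sym G (proj₁ (leaves⁻ z∈))

    offʷ : ∀ {z} → z ∈ leaves w → OffSpine z
    offʷ z∈ = leafʷ-off z∈ , w , here refl , Adj-sym G (proj₁ (leaves⁻ z∈))

    -- With z added to the spine, an edge to z would be a second edge from z′ into a connected set.
    off-independent : ∀ {z z′} → OffSpine z → OffSpine z′ → ¬ Adj G z z′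
    off-independent {z} {z′} (z∉ , x , x∈ , zx) (z′∉ , x′ , x′∈ , z′x′) zz′ =
      z∉ (subst (_∈ spine) (one-parent (grow spine-built x∈ zx z∉) (Adj⇒≢ G zz′ ∘ ≡-sym ∷∉ z′∉) (there x′∈) (here refl)
        z′x′ (Adj-sym G zz′)) x′∈)

  p q : ℕ
  p = length (leaves u)
  q = length (leaves w)

  p≥1 : ∀ {z} → Adj G u z → z ≢ v → 1 ≤ p
  p≥1 uz z≢v = ∈⇒1≤length (leaves⁺ uz z≢v)

  q≥1 : ∀ {z} → Adj G w z → z ≢ v → 1 ≤ q
  q≥1 wz z≢v = ∈⇒1≤length (leaves⁺ wz z≢v)

  private
    -- The order is that of the numbering in `T`: centre, its two neighbours, then the leaves of
    -- each.
    order : List (Fin n)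
    order = v ∷ u ∷ w ∷ leaves u ++ leaves w

    order-unique : Unique order
    order-unique =
         (Adj⇒≢ G (Adj-sym G uv) ∷∉ Adj⇒≢ G vw ∷∉ ∉leaves (there (here refl)))
      ∷ᵘ (u≢w ∷∉ ∉leaves (there (there (here refl))))
      ∷ᵘ ∉leaves (here refl)
      ∷ᵘ Unique.++⁺ (leaves-unique u) (leaves-unique w)
           (λ (z∈u , z∈w) → u≢w (leafᵘ-parent z∈u (here refl) (Adj-sym G (proj₁ (leaves⁻ z∈w)))))
      where
      ∉leaves : ∀ {x} → x ∈ spine → x ∉ leaves u ++ leaves w
      ∉leaves x∈ z∈ with ∈-++⁻ (leaves u) z∈
      ... | inj₁ z∈u = leafᵘ-off z∈u x∈
      ... | inj₂ z∈w = leafʷ-off z∈w x∈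

    order-complete : ∀ z → z ∈ order
    order-complete z with z ≟ v | z ≟ u | z ≟ w
    ... | yes refl | _ | _ = here refl
    ... | no _ | yes refl | _ = there (here refl)
    ... | no _ | no _ | yes refl = there (there (here refl))
    ... | no z≢v | no z≢u | no z≢w with cover z (z≢u ∷∉ z≢v ∷∉ z≢w ∷∉ ∉[])
    ... | inj₁ uz = there (there (there (∈-++⁺ˡ (leaves⁺ uz z≢v))))
    ... | inj₂ wz = there (there (there (∈-++⁺ʳ (leaves u) (leaves⁺ wz z≢v))))

    size : p + q + 3 ≡ length order
    size = trans (+-comm (p + q) 3) (cong (3 +_) (≡-sym (length-++ (leaves u))))

    vertex : Fin (p + q + 3) → Fin n
    vertex i = lookup order (cast size i)

    position : Fin n → Fin (p + q + 3)
    position z = cast (≡-sym size) (Any.index (order-complete z))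

    vertex-position : ∀ z → vertex (position z) ≡ z
    vertex-position z = trans (cong (lookup order) (cast-involutive size (≡-sym size) _))
      (≡-sym (lookup-index (order-complete z)))

    position-vertex : ∀ i → position (vertex i) ≡ i
    position-vertex i = trans (≡-sym (cast-involutive (≡-sym size) size _))
      (trans (cong (cast (≡-sym size)) (lookup-injective order-unique (vertex-position (vertex i))))
        (cast-involutive (≡-sym size) size i))

    -- Ties an index of `T` to the place of its vertex in the tree, so that adjacency can be
    -- compared by cases on two roles.
    data Role : ℕ → Fin n → Set where
      centre : Role 0 v
      left   : Role 1 u
      right  : Role 2 w
      leafᵘ  : ∀ {m z} → m < p → z ∈ leaves u → Role (3 + m) z
      leafʷ  : ∀ {m z} → z ∈ leaves w → Role (3 + (p + m)) z

    role-lookup : ∀ i → Role (toℕ i) (lookup order i)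
    role-lookup fzero = centre
    role-lookup (fsuc fzero) = left
    role-lookup (fsuc (fsuc fzero)) = right
    role-lookup (fsuc (fsuc (fsuc i))) with lookup-++-split (leaves u) (leaves w) i
    ... | inj₁ (lt , z∈) = leafᵘ lt z∈
    ... | inj₂ (m , eq , z∈) rewrite eq = leafʷ z∈

    role : ∀ i → Role (toℕ i) (vertex i)
    role i = subst (λ j → Role j (vertex i)) (toℕ-cast size i) (role-lookup (cast size i))

    edge : ℕ → ℕ → Bool
    edge i j = Tedge p i j ∨ Tedge p j i

    flip : ∀ {i j z z′} → edge j i ≡ adj G z′ z → edge i j ≡ adj G z z′
    flip {i} {j} {z} {z′} eq = trans (∨-comm (Tedge p i j) _) (trans eq (Graph.sym G z′ z))

    non : ∀ {z z′} → ¬ Adj G z z′ → false ≡ adj G z z′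
    non ¬zz′ = ≡-sym (¬-not ¬zz′)

    edge-role : ∀ {i j z z′} → Role i z → Role j z′ → edge i j ≡ adj G z z′
    edge-role centre centre = non (Adj-irrefl G)
    edge-role centre left = ≡-sym (Adj-sym G uv)
    edge-role centre right = ≡-sym vw
    edge-role centre (leafᵘ _ z∈) = non λ vz → Adj⇒≢ G uv (leafᵘ-parent z∈ (there (here refl)) (Adj-sym G vz))
    edge-role centre (leafʷ z∈) = non λ vz → Adj⇒≢ G vw (≡-sym (leafʷ-parent z∈ (there (here refl)) (Adj-sym G vz)))
    edge-role left centre = ≡-sym uv
    edge-role left left = non (Adj-irrefl G)
    edge-role left right = non u≁w
    edge-role left (leafᵘ lt z∈) rewrite <⇒<ᵇ≡true lt = ≡-sym (proj₁ (leaves⁻ z∈))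
    edge-role left (leafʷ {m} z∈) rewrite ≥⇒<ᵇ≡false (m≤m+n p m) =
      non λ uz → u≢w (≡-sym (leafʷ-parent z∈ (there (there (here refl))) (Adj-sym G uz)))
    edge-role right centre = ≡-sym (Adj-sym G vw)
    edge-role right left = non (u≁w ∘ Adj-sym G)
    edge-role right right = non (Adj-irrefl G)
    edge-role right (leafᵘ lt z∈) rewrite ≥⇒<ᵇ≡false lt =
      non λ wz → u≢w (leafᵘ-parent z∈ (here refl) (Adj-sym G wz))
    edge-role right (leafʷ {m} z∈) rewrite <⇒<ᵇ≡true (s≤s (m≤m+n p m)) = ≡-sym (proj₁ (leaves⁻ z∈))
    edge-role (leafᵘ lt z∈) (leafᵘ lt′ z∈′) = non (off-independent (offᵘ z∈) (offᵘ z∈′))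
    edge-role (leafᵘ lt z∈) (leafʷ z∈′) = non (off-independent (offᵘ z∈) (offʷ z∈′))
    edge-role (leafʷ z∈) (leafᵘ lt z∈′) = non (off-independent (offʷ z∈) (offᵘ z∈′))
    edge-role (leafʷ z∈) (leafʷ z∈′) = non (off-independent (offʷ z∈) (offʷ z∈′))
    edge-role (leafᵘ {m} lt z∈) centre = flip {3 + m} {0} (edge-role {0} {3 + m} centre (leafᵘ lt z∈))
    edge-role (leafᵘ {m} lt z∈) left = flip {3 + m} {1} (edge-role {1} {3 + m} left (leafᵘ lt z∈))
    edge-role (leafᵘ {m} lt z∈) right = flip {3 + m} {2} (edge-role {2} {3 + m} right (leafᵘ lt z∈))
    edge-role (leafʷ {m} z∈) centre = flip {3 + (p + m)} {0} (edge-role {0} {3 + (p + m)} centre (leafʷ z∈))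
    edge-role (leafʷ {m} z∈) left = flip {3 + (p + m)} {1} (edge-role {1} {3 + (p + m)} left (leafʷ z∈))
    edge-role (leafʷ {m} z∈) right = flip {3 + (p + m)} {2} (edge-role {2} {3 + (p + m)} right (leafʷ z∈))

  p+q+3≡n : p + q + 3 ≡ n
  p+q+3≡n = ≤-antisym (subst (_≤ n) (≡-sym size) (unique-length order-unique))
    (subst₂ _≤_ (allFin-length n) (≡-sym size) (unique-⊆⇒length-≤ (Unique.allFin⁺ n) λ _ → order-complete _))

  iso : Iso G (T p q)
  iso = mk↔ₛ′ position vertex position-vertex vertex-position , λ i j →
    trans (edge-role (role (position i)) (role (position j))) (cong₂ (adj G) (vertex-position i) (vertex-position j))

-- Components

module _ (H : Graph N) where

  exit? : ∀ U → Dec (Exit H U)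
  exit? U = any? λ w → any? λ z → (w ∈? U) ×-dec (¬? (z ∈? U) ×-dec adj? H w z)

  path-exit : ∀ {U p xs q} → Path H p xs q → p ∈ U → q ∉ U → Exit H U
  path-exit stop p∈U q∉U = contradiction p∈U q∉U
  path-exit {U} (step {r = r} pr _ π) p∈U q∉U with r ∈? U
  ... | yes r∈U = path-exit π r∈U q∉U
  ... | no r∉U = _ , r , p∈U , r∉U , pr

  Closed : List (Fin N) → Set
  Closed U = ¬ Exit H U

  closed-step : ∀ {U a b} → Closed U → a ∈ U → Adj H a b → b ∈ U
  closed-step {U} {a} {b} closed a∈ ab = decidable-stable (b ∈? U) λ b∉ → closed (a , b , a∈ , b∉ , ab)

  component : ∀ a → ∃ λ K → Built H K × a ∈ K × Closed K
  component a = go N (root a) (here refl) (m≤n+m N 1)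
    where
    go : ∀ fuel {K} → Built H K → a ∈ K → N ≤ length K + fuel → ∃ λ K → Built H K × a ∈ K × Closed K
    go fuel {K} b a∈ le with exit? K
    ... | no closed = K , b , a∈ , closed
    go zero {K} b a∈ le | yes (w , z , w∈ , z∉ , wz) =
      contradiction (unique-length (z∉ ∷ᵘ Built-unique H b)) (≤⇒≯ (subst (N ≤_) (+-identityʳ _) le))
    go (suc fuel) {K} b a∈ le | yes (w , z , w∈ , z∉ , wz) =
      go fuel (grow b w∈ (Adj-sym H wz) z∉) (there a∈) (subst (N ≤_) (+-suc _ fuel) le)

  -- A set of fewer than n vertices misses a vertex of K, and a path from a to that vertex leaves
  -- the set.
  Built-big : ∀ {n K} → Built H K → n ≤ length K → ∀ {a} → a ∈ K → Big n H a
  Built-big b n≤K a∈K U a∈U U<n with pigeonhole (Built-unique H b) (≤-trans U<n n≤K)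
  ... | z , z∈K , z∉U with Built-path H b a∈K z∈K
  ... | _ , π , _ = path-exit π a∈U z∉U

  -- A component contains a closed neighbourhood, hence at least n - 2 vertices; if it has fewer
  -- than n, its size is n - 1 or n - 2. Exhausting the graph by such components, collected in D,
  -- writes N as a linear combination.
  large-component : ∀ {n} → (∀ h → n ≤ 3 + length (nbrs H h)) →
    (∃ λ K → Built H K × Closed K × n ≤ length K) ⊎ LinComb2 N (n ∸ 1) (n ∸ 2)
  large-component {n} mindeg = go N [] [] (λ ()) (0 , 0 , refl) ≤-refl
    where
    go : ∀ fuel D → Unique D → Closed D → LinComb2 (length D) (n ∸ 1) (n ∸ 2) → N ≤ length D + fuel →
      (∃ λ K → Built H K × Closed K × n ≤ length K) ⊎ LinComb2 N (n ∸ 1) (n ∸ 2)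
    go fuel D uD D-closed (i , j , eq) le with full? D
    ... | inj₁ full = inj₂ (i , j , trans eq (≤-antisym (unique-length uD)
      (subst (_≤ length D) (allFin-length N) (unique-⊆⇒length-≤ (Unique.allFin⁺ N) λ _ → full _))))
    go zero D uD D-closed lc le | inj₂ (a , a∉) =
      contradiction (unique-length (a∉ ∷ᵘ uD)) (≤⇒≯ (subst (N ≤_) (+-identityʳ _) le))
    go (suc fuel) D uD D-closed (i , j , eq) le | inj₂ (a , a∉) with component a
    ... | K , b , a∈ , K-closed with n ≤? length K
    ... | yes n≤K = inj₁ (K , b , K-closed , n≤K)
    ... | no n≰K = go fuel (K ++ D) (Unique.++⁺ (Built-unique H b) uD disjoint) closed lincomb
      (≤-trans le (≤-trans (≤-reflexive (+-suc _ fuel)) (+-monoˡ-≤ fuel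
        (≤-trans (+-monoˡ-≤ (length D) 1≤K) (≤-reflexive (≡-sym (length-++ K)))))))
      where
      disjoint : ∀ {z} → ¬ (z ∈ K × z ∈ D)
      disjoint (z∈K , z∈D) = let _ , π , _ = Built-path H b z∈K a∈ in D-closed (path-exit π z∈D a∉)
      closed : Closed (K ++ D)
      closed (w , z , w∈ , z∉ , wz) with ∈-++⁻ K w∈
      ... | inj₁ w∈K = z∉ (∈-++⁺ˡ (closed-step K-closed w∈K wz))
      ... | inj₂ w∈D = z∉ (∈-++⁺ʳ K (closed-step D-closed w∈D wz))
      deg<K : suc (length (nbrs H a)) ≤ length K
      deg<K = unique-⊆⇒length-≤ (closed-nbrs-unique H a) λ where
        (here refl) → a∈
        (there z∈) → closed-step K-closed a∈ (nbrs⁻ H z∈)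
      1≤K : 1 ≤ length K
      1≤K = ≤-trans (s≤s z≤n) deg<K
      lengths : ∀ n K → n ≤ 2 + K → K < n → K ≡ n ∸ 1 ⊎ K ≡ n ∸ 2
      lengths (suc n) K le (s≤s lt) with m≤n⇒m<n∨m≡n lt
      ... | inj₂ K≡n = inj₁ K≡n
      lengths (suc (suc n)) K le _ | inj₁ (s≤s lt) = inj₂ (≤-antisym lt (s≤s⁻¹ (s≤s⁻¹ le)))
      lincomb : LinComb2 (length (K ++ D)) (n ∸ 1) (n ∸ 2)
      lincomb with lengths n (length K) (≤-trans (mindeg a) (s≤s (s≤s deg<K))) (≰⇒> n≰K)
      ... | inj₁ K≡ = suc i , j , trans (+-assoc (n ∸ 1) _ _) (trans (cong₂ _+_ (≡-sym K≡) eq) (≡-sym (length-++ K)))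
      ... | inj₂ K≡ = i , suc j , trans (+-comm (i * (n ∸ 1)) _)
        (trans (+-assoc (n ∸ 2) _ _)
          (trans (cong₂ _+_ (≡-sym K≡) (trans (+-comm _ (i * (n ∸ 1))) eq)) (≡-sym (length-++ K))))

-- The red graph of a colouring and blue stars

isRed : Colour → Bool
isRed red = true
isRed blue = false

redGraph : Colouring N → Graph N
redGraph {N} χ = record { adj = redAdj ; sym = redAdj-sym ; irrefl = redAdj-irrefl }
  where
  redAdj : Fin N → Fin N → Bool
  redAdj i j with i ≟ j
  ... | yes _ = false
  ... | no _ = isRed (col χ i j)
  redAdj-sym : ∀ i j → redAdj i j ≡ redAdj j i
  redAdj-sym i j with i ≟ j | j ≟ i
  ... | yes _ | yes _ = refl
  ... | yes i≡j | no j≢i = contradiction (≡-sym i≡j) j≢i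
  ... | no i≢j | yes j≡i = contradiction (≡-sym j≡i) i≢j
  ... | no _ | no _ = cong isRed (col-sym χ i j)
  redAdj-irrefl : ∀ i → redAdj i i ≡ false
  redAdj-irrefl i with i ≟ i
  ... | yes _ = refl
  ... | no i≢i = contradiction refl i≢i

redGraph⇒red : ∀ (χ : Colouring N) {i j} → Adj (redGraph χ) i j → col χ i j ≡ red
redGraph⇒red χ {i} {j} ij with i ≟ j
redGraph⇒red χ {i} {j} () | yes _
redGraph⇒red χ {i} {j} ij | no _ with col χ i j
... | red = refl
redGraph⇒red χ {i} {j} () | no _ | blue

¬redGraph⇒blue : ∀ (χ : Colouring N) {i j} → i ≢ j → ¬ Adj (redGraph χ) i j → col χ i j ≡ blue
¬redGraph⇒blue χ {i} {j} i≢j ij with i ≟ j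
... | yes i≡j = contradiction i≡j i≢j
... | no _ with col χ i j
... | red = contradiction refl ij
... | blue = refl

-- At least m vertices lie outside the closed red neighbourhood of v, and all of them are joined to
-- v in blue.
blue-star : ∀ (χ : Colouring N) m v → m + suc (length (nbrs (redGraph χ) v)) ≤ N → Copy blue (star m) χ
blue-star {N} χ m v le = f , inj , hom
  where
  H = redGraph χ
  far? : ∀ z → Dec (z ∉ v ∷ nbrs H v)
  far? z = ¬? (z ∈? (v ∷ nbrs H v))
  blues : List (Fin N)
  blues = filter far? (allFin N)
  blues-unique : Unique blues
  blues-unique = Unique.filter⁺ far? (Unique.allFin⁺ N)
  blues-far : ∀ {z} → z ∈ blues → z ∉ v ∷ nbrs H v
  blues-far z∈ = proj₂ (∈-filter⁻ far? {xs = allFin N} z∈)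
  m≤blues : m ≤ length blues
  m≤blues = +-cancelʳ-≤ (suc (length (nbrs H v))) m (length blues) (≤-trans le
    (subst₂ _≤_ (allFin-length N) (length-++ blues) (unique-⊆⇒length-≤ (Unique.allFin⁺ N) cover)))
    where
    cover : ∀ {z} → z ∈ allFin N → z ∈ blues ++ v ∷ nbrs H v
    cover {z} _ with z ∈? (v ∷ nbrs H v)
    ... | yes z∈ = ∈-++⁺ʳ blues z∈
    ... | no z∉ = ∈-++⁺ˡ (∈-filter⁺ far? (∈-allFin z) z∉)
  leaf : Fin m → Fin N
  leaf i = lookup blues (inject≤ i m≤blues)
  leaf-far : ∀ i → leaf i ∉ v ∷ nbrs H v
  leaf-far i = blues-far (∈-lookup (inject≤ i m≤blues))
  f : Fin (suc m) → Fin N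
  f fzero = v
  f (fsuc i) = leaf i
  inj : ∀ {i j} → f i ≡ f j → i ≡ j
  inj {fzero} {fzero} _ = refl
  inj {fzero} {fsuc j} eq = contradiction (here (≡-sym eq)) (leaf-far j)
  inj {fsuc i} {fzero} eq = contradiction (here eq) (leaf-far i)
  inj {fsuc i} {fsuc j} eq = cong fsuc (inject≤-injective m≤blues m≤blues i j (lookup-injective blues-unique eq))
  v-blue : ∀ i → col χ v (leaf i) ≡ blue
  v-blue i = ¬redGraph⇒blue χ (λ eq → leaf-far i (here (≡-sym eq))) (leaf-far i ∘ there ∘ nbrs⁺ H {v})
  hom : ∀ i j → starAdj i j ≡ true → col χ (f i) (f j) ≡ blue
  hom fzero (fsuc j) _ = v-blue j
  hom (fsuc i) fzero _ = trans (col-sym χ (leaf i) v) (v-blue i)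

-- Shapes of a rooted tree

module TreeShape {n : ℕ} (G : Graph n) (tree : IsTree G) where

  -- The position of the last but one vertex of a longest path: all neighbours of u except possibly
  -- v are leaves, and x is one of them.
  record Penultimate (u v x : Fin n) : Set where
    field
      uv : Adj G u v
      ux : Adj G u x
      x≢v : x ≢ v
      leaf : ∀ {w z} → Adj G u w → w ≢ v → Adj G w z → z ≡ u

  -- Walk away from v: a neighbour w ≢ v of u with a neighbour other than u takes the role of u.
  penultimate : 3 ≤ n → ∃ λ u → ∃ λ v → ∃ λ x → Penultimate u v x
  penultimate n≥3 with branching
    where
    branching : ∃ λ t → ∃ λ s → ∃ λ x → Adj G t s × Adj G t x × x ≢ s
    branching with missing [] (≤-trans (s≤s z≤n) n≥3)
    ... | p , _ with connected-exit G (proj₁ tree) (p ∷ []) (here refl)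
    ... | inj₁ full = contradiction (full _) (proj₂ (missing (p ∷ []) (≤-trans (s≤s (s≤s z≤n)) n≥3)))
    ... | inj₂ (_ , q , here refl , q∉ , pq) with connected-exit G (proj₁ tree) (p ∷ q ∷ []) (here refl)
    ... | inj₁ full = contradiction (full _) (proj₂ (missing (p ∷ q ∷ []) n≥3))
    ... | inj₂ (_ , r , here refl , r∉ , pr) = p , q , r , pq , pr , λ r≡q → r∉ (there (here r≡q))
    ... | inj₂ (_ , r , there (here refl) , r∉ , qr) = q , p , r , Adj-sym G pq , qr , λ r≡p → r∉ (here r≡p)
  ... | t , s , x , ts , tx , x≢s =
    go n (root s) (here refl) (Adj⇒≢ G ts ∷∉ ∉[]) ts tx x≢s (m≤n+m n 1)
    where
    go : ∀ fuel {L t s x} → Built G L → s ∈ L → t ∉ L → Adj G t s → Adj G t x → x ≢ s → n ≤ length L + fuel →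
      ∃ λ u → ∃ λ v → ∃ λ x → Penultimate u v x
    go fuel {L} {t} {s} {x} b s∈ t∉ ts tx x≢s le
      with any? (λ w → adj? G t w ×-dec ¬? (w ≟ s) ×-dec any? (λ z → adj? G w z ×-dec ¬? (z ≟ t)))
    ... | no ¬p = t , s , x , record
      { uv = ts ; ux = tx ; x≢v = x≢s
      ; leaf = λ {w} {z} tw w≢s wz → decidable-stable (z ≟ t) λ z≢t → ¬p (w , tw , w≢s , z , wz , z≢t) }
    go zero {L} b s∈ t∉ ts tx x≢s le | yes _ =
      contradiction (unique-length (t∉ ∷ᵘ Built-unique G b)) (≤⇒≯ (subst (n ≤_) (+-identityʳ _) le))
    go (suc fuel) {L} {t} {s} b s∈ t∉ ts tx x≢s le | yes (w , tw , w≢s , z , wz , z≢t) =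
      go fuel (grow b s∈ ts t∉) (here refl) (Adj⇒≢ G tw ∘ ≡-sym ∷∉ w∉L) (Adj-sym G tw) wz z≢t
        (subst (n ≤_) (+-suc _ fuel) le)
      where
      -- The walk cannot return to L, to which t has s as its only neighbour; hence it ends.
      w∉L : w ∉ L
      w∉L w∈L = w≢s (unique-parent G (proj₂ tree) b t∉ w∈L s∈ tw ts)

  -- The parts of the tree near ρ that fit the host configurations: `fork` and `bifork` fit those of
  -- the same name, and `path` has four edges so that it fits a zigzag as well as a far path. All
  -- avoid the vertices set aside in Z.
  data Shape (ρ : Fin n) (Z : List (Fin n)) : Set where
    fork : ∀ {v c c′} → Adj G ρ v → Adj G v c → Adj G v c′ → c ≢ ρ → c′ ≢ ρ → c ≢ c′ →
      v ∉ Z → c ∉ Z → c′ ∉ Z → Shape ρ Z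
    bifork : ∀ {v c v′ c′} → Adj G ρ v → Adj G v c → Adj G ρ v′ → Adj G v′ c′ → v ≢ v′ → c ≢ c′ →
      c ∉ ρ ∷ nbrs G ρ → c′ ∉ ρ ∷ nbrs G ρ → v ∉ Z → c ∉ Z → v′ ∉ Z → c′ ∉ Z → Shape ρ Z
    path : ∀ {v c d e} → Adj G ρ v → Adj G v c → Adj G c d → Adj G d e →
      c ∉ v ∷ ρ ∷ [] → d ∉ c ∷ v ∷ ρ ∷ [] → e ∉ d ∷ c ∷ v ∷ ρ ∷ [] →
      v ∉ Z → c ∉ Z → d ∉ Z → e ∉ Z → Shape ρ Z

  module Rooted {ρ : Fin n} {Z : List (Fin n)} (sealed : ∀ {z w} → z ∈ Z → Adj G z w → w ∈ Z ⊎ w ≡ ρ) where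

    U₀ : List (Fin n)
    U₀ = Z ++ ρ ∷ nbrs G ρ

    ρ∈U₀ : ρ ∈ U₀
    ρ∈U₀ = ∈-++⁺ʳ Z (here refl)

    exit-U₀ : ∀ {w z} → w ∈ U₀ → z ∉ U₀ → Adj G w z → Adj G ρ w × w ∉ Z
    exit-U₀ {w} {z} w∈ z∉ wz with ∈-++⁻ Z w∈
    ... | inj₁ w∈Z = contradiction (case sealed w∈Z wz of λ { (inj₁ z∈Z) → ∈-++⁺ˡ z∈Z ; (inj₂ refl) → ρ∈U₀ }) z∉
    ... | inj₂ (here refl) = contradiction (∈-++⁺ʳ Z (there (nbrs⁺ G wz))) z∉
    ... | inj₂ (there w∈N) = nbrs⁻ G w∈N , λ w∈Z →
      z∉ (case sealed w∈Z wz of λ { (inj₁ z∈Z) → ∈-++⁺ˡ z∈Z ; (inj₂ refl) → ρ∈U₀ })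

    record Stem : Set where
      field
        {v c} : Fin n
        ρv : Adj G ρ v
        v∉Z : v ∉ Z
        vc : Adj G v c
        c∉U₀ : c ∉ U₀
      c≢ρ : c ≢ ρ
      c≢ρ = ∉⇒≢ c∉U₀ ρ∈U₀
      c∉Z : c ∉ Z
      c∉Z = c∉U₀ ∘ ∈-++⁺ˡ

    stem : ∃ (_∉ U₀) → Stem
    stem (z , z∉) with connected-exit G (proj₁ tree) U₀ ρ∈U₀
    ... | inj₁ full = contradiction (full z) z∉
    ... | inj₂ (v , c , v∈ , c∉ , vc) =
      let ρv , v∉Z = exit-U₀ v∈ c∉ vc in record { ρv = ρv ; v∉Z = v∉Z ; vc = vc ; c∉U₀ = c∉ }

    module _ (s : Stem) where
      open Stem s

      -- A second edge leaving `U₀` gives a fork if it starts at v too, and a bifork otherwise.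
      branch : ∀ {w z} → w ∈ U₀ → z ∉ U₀ → Adj G w z → z ≢ c → Shape ρ Z
      branch {w} {z} w∈ z∉ wz z≢c with exit-U₀ w∈ z∉ wz | w ≟ v
      ... | ρw , w∉Z | yes refl =
        fork ρv vc wz c≢ρ (∉⇒≢ z∉ ρ∈U₀) (z≢c ∘ ≡-sym) v∉Z c∉Z (z∉ ∘ ∈-++⁺ˡ)
      ... | ρw , w∉Z | no w≢v =
        bifork ρv vc ρw wz (w≢v ∘ ≡-sym) (z≢c ∘ ≡-sym) (c∉U₀ ∘ ∈-++⁺ʳ Z) (z∉ ∘ ∈-++⁺ʳ Z)
          v∉Z c∉Z w∉Z (z∉ ∘ ∈-++⁺ˡ)

      -- The search proceeds outwards from c. Without a shape, nothing lies beyond `U₀` except c, or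
      -- nothing except c and neighbours of c.
      explore : Shape ρ Z ⊎ (∀ z → z ∈ c ∷ U₀) ⊎
        (∃ λ d → Adj G c d × d ∉ c ∷ U₀ × (∀ z → z ∈ c ∷ nbrs G c ++ U₀))
      explore with connected-exit G (proj₁ tree) (c ∷ U₀) (here refl)
      ... | inj₁ full = inj₂ (inj₁ full)
      ... | inj₂ (w , z , there w∈ , z∉ , wz) = inj₁ (branch w∈ (z∉ ∘ there) wz (∉⇒≢ z∉ (here refl)))
      ... | inj₂ (_ , d , here refl , d∉ , cd) with connected-exit G (proj₁ tree) (c ∷ nbrs G c ++ U₀) (here refl)
      ... | inj₁ full = inj₂ (inj₂ (d , cd , d∉ , full))
      ... | inj₂ (_ , z , here refl , z∉ , cz) = contradiction (there (∈-++⁺ˡ (nbrs⁺ G cz))) z∉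
      ... | inj₂ (w , z , there w∈ , z∉ , wz) with w ∈? U₀
      ... | yes w∈U₀ = inj₁ (branch w∈U₀ (z∉ ∘ there ∘ ∈-++⁺ʳ (nbrs G c)) wz (∉⇒≢ z∉ (here refl)))
      ... | no w∉U₀ with ∈-++⁻ (nbrs G c) w∈
      ... | inj₂ w∈U₀ = contradiction w∈U₀ w∉U₀
      ... | inj₁ w∈N = inj₁ (path ρv vc (nbrs⁻ G w∈N) wz
          (c∉ c∉U₀)
          (Adj⇒≢ G (nbrs⁻ G w∈N) ∘ ≡-sym ∷∉ c∉ w∉U₀)
          (Adj⇒≢ G wz ∘ ≡-sym ∷∉ ∉⇒≢ z∉ (here refl) ∷∉ c∉ (z∉ ∘ there ∘ ∈-++⁺ʳ (nbrs G c)))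
          v∉Z c∉Z (w∉U₀ ∘ ∈-++⁺ˡ) (z∉ ∘ there ∘ ∈-++⁺ʳ (nbrs G c) ∘ ∈-++⁺ˡ))
        where
        c∉ : ∀ {z} → z ∉ U₀ → z ∉ v ∷ ρ ∷ []
        c∉ z∉ = ∉⇒≢ z∉ (∈-++⁺ʳ Z (there (nbrs⁺ G ρv))) ∷∉ ∉⇒≢ z∉ ρ∈U₀ ∷∉ ∉[]

-- Embedding the tree

module EmbedTree {n N : ℕ} (G : Graph n) (tree : IsTree G) (maxdeg : ∀ v → 3 + length (nbrs G v) ≤ n)
  (not-T : ∀ p q → 1 ≤ p → 1 ≤ q → p + q + 3 ≡ n → ¬ Iso G (T p q))
  (H : Graph N) (mindeg : ∀ h → n ≤ 3 + length (nbrs H h))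
  (K : List (Fin N)) (K-closed : ∀ {a b} → a ∈ K → Adj H a b → b ∈ K)
  (K-big : ∀ {a} → a ∈ K → Big n H a) {a₀ : Fin N} (a₀∈K : a₀ ∈ K) where

  open PartialEmbeddings G H tree
  open TreeShape G tree
  open InducedP₃

  -- The domain is fixed exactly, so that it can be checked to avoid Z; readiness of the image of ρ
  -- then outlasts the greedy phase.
  record Start (ρ : Fin n) (ds : List (Fin n)) : Set where
    constructor started
    field
      {L} : Pairs
      {image} : Fin N
      embeds : Partial L
      domain : dom L ≡ ds
      ρ∈ : (ρ , image) ∈ L
      ready : Ready image L

  path₃ : ∀ {ρ v c a b d} → Adj G ρ v → Adj G v c → c ≢ ρ → InducedP₃ H a b d →
    Partial ((c , d) ∷ (v , b) ∷ (ρ , a) ∷ [])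
  path₃ ρv vc c≢ρ abd =
    attach (attach (start _ _) (here refl) ρv (Adj⇒≢ G (Adj-sym G ρv) ∷∉ ∉[]) (a~b abd) (Adj⇒≢ H (Adj-sym H (a~b abd)) ∷∉ ∉[]))
      (here refl) vc (Adj⇒≢ G (Adj-sym G vc) ∷∉ c≢ρ ∷∉ ∉[])
      (b~c abd) (Adj⇒≢ H (Adj-sym H (b~c abd)) ∷∉ a≢c abd ∘ ≡-sym ∷∉ ∉[])

  -- The count is the degree of a, a itself and its used non-neighbours: one of these suffices for
  -- degree n - 2, and two, as in `ready₃`, for degree n - 3.
  ready₂ : ∀ {a b L} → n ≤ 2 + length (nbrs H a) → a ∈ cod L → b ∈ cod L → ¬ Adj H a b → a ≢ b → Ready a L
  ready₂ le a∈ b∈ ab a≢b = room ((a≢b ∷∉ ∉[]) ∷ᵘ ∉[] ∷ᵘ [])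
    (λ { (here refl) → a∈ ; (there (here refl)) → b∈ })
    (λ { (here refl) → Adj-irrefl H ; (there (here refl)) → ab }) le

  ready₃ : ∀ {a b c L} → a ∈ cod L → b ∈ cod L → c ∈ cod L → ¬ Adj H a b → ¬ Adj H a c → a ≢ b → a ≢ c → b ≢ c → Ready a L
  ready₃ {a} a∈ b∈ c∈ ab ac a≢b a≢c b≢c = room ((a≢b ∷∉ a≢c ∷∉ ∉[]) ∷ᵘ (b≢c ∷∉ ∉[]) ∷ᵘ ∉[] ∷ᵘ [])
    (λ { (here refl) → a∈ ; (there (here refl)) → b∈ ; (there (there (here refl))) → c∈ })
    (λ { (here refl) → Adj-irrefl H ; (there (here refl)) → ab ; (there (there (here refl))) → ac }) (mindeg a)

  Irregular : Set
  Irregular = ∃ λ a → a ∈ K × n ≤ 2 + length (nbrs H a)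

  -- Degree n - 1 or more makes a ready on its own. For degree n - 2, an induced path from a puts c
  -- on the one non-neighbour required.
  irregular-start : ∀ {ρ v c} → Irregular → Adj G ρ v → Adj G v c → c ≢ ρ →
    Start ρ (ρ ∷ []) ⊎ Start ρ (c ∷ v ∷ ρ ∷ [])
  irregular-start {ρ} (a , a∈K , le) ρv vc c≢ρ with n ≤? 1 + length (nbrs H a)
  ... | yes le′ = inj₁ (started (start ρ a) refl (here refl)
    (room (∉[] ∷ᵘ []) (λ { (here refl) → here refl }) (λ { (here refl) → Adj-irrefl H }) le′))
  ... | no ¬le with inducedP₃-from H (K-big a∈K) (≰⇒> ¬le)
  ... | b , d , abd = inj₂ (started (path₃ ρv vc c≢ρ abd) refl (there (there (here refl)))
    (ready₂ le (there (there (here refl))) (here refl) (a≁c abd) (a≢c abd)))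

  Regular : Set
  Regular = ∀ {a} → a ∈ K → 3 + length (nbrs H a) ≡ n

  regular? : Irregular ⊎ Regular
  regular? with any? (λ a → (a ∈? K) ×-dec (n ≤? 2 + length (nbrs H a)))
  ... | yes p = inj₁ p
  ... | no ¬p = inj₂ λ {a} a∈ → ≤-antisym (≰⇒> λ le → ¬p (a , a∈ , le)) (mindeg a)

  module OnRegular (regular : Regular) where

    open RegularHost H (_∈ K) (_∈? K) K-closed K-big regular public

    bifork-start : ∀ {ρ v c v′ c′ b a p e r} → Bifork b a p e r → Adj G ρ v → Adj G v c → Adj G ρ v′ → Adj G v′ c′ → v ≢ v′ → c ≢ c′ →
      c ∉ ρ ∷ nbrs G ρ → c′ ∉ ρ ∷ nbrs G ρ → Start ρ (c′ ∷ v′ ∷ c ∷ v ∷ ρ ∷ [])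
    bifork-start (_ , bap , ber , a≢e , p≢r) ρv vc ρv′ v′c′ v≢v′ c≢c′ c∉ c′∉ = started
      (attach (attach (path₃ ρv vc (∉⇒≢ c∉ (here refl)) bap)
          (there (there (here refl))) ρv′
          (∉⇒≢ c∉ (there (nbrs⁺ G ρv′)) ∘ ≡-sym ∷∉ v≢v′ ∘ ≡-sym ∷∉ Adj⇒≢ G (Adj-sym G ρv′) ∷∉ ∉[])
          (a~b ber) ((λ { refl → a≁c bap (a~b ber) }) ∷∉ a≢e ∘ ≡-sym ∷∉ Adj⇒≢ H (Adj-sym H (a~b ber)) ∷∉ ∉[]))
        (here refl) v′c′
        (Adj⇒≢ G (Adj-sym G v′c′) ∷∉ c≢c′ ∘ ≡-sym ∷∉ ∉⇒≢ c′∉ (there (nbrs⁺ G ρv)) ∷∉ ∉⇒≢ c′∉ (here refl) ∷∉ ∉[])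
        (b~c ber)
        (Adj⇒≢ H (Adj-sym H (b~c ber)) ∷∉ p≢r ∘ ≡-sym ∷∉ (λ { refl → a≁c ber (a~b bap) }) ∷∉ a≢c ber ∘ ≡-sym ∷∉ ∉[]))
      refl (there (there (there (there (here refl)))))
      (ready₃ (there (there (there (there (here refl))))) (there (there (here refl))) (here refl)
        (a≁c bap) (a≁c ber) (a≢c bap) (a≢c ber) p≢r)

    fork-start : ∀ {ρ v c c′ a b d d′} → Fork a b d d′ → Adj G ρ v → Adj G v c → Adj G v c′ → c ≢ ρ → c′ ≢ ρ → c ≢ c′ →
      Start ρ (c′ ∷ c ∷ v ∷ ρ ∷ [])
    fork-start (_ , abd , abd′ , d≢d′) ρv vc vc′ c≢ρ c′≢ρ c≢c′ = started
      (attach (path₃ ρv vc c≢ρ abd) (there (here refl)) vc′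
        (c≢c′ ∘ ≡-sym ∷∉ Adj⇒≢ G (Adj-sym G vc′) ∷∉ c′≢ρ ∷∉ ∉[])
        (b~c abd′) (d≢d′ ∘ ≡-sym ∷∉ Adj⇒≢ H (Adj-sym H (b~c abd′)) ∷∉ a≢c abd′ ∘ ≡-sym ∷∉ ∉[]))
      refl (there (there (there (here refl))))
      (ready₃ (there (there (there (here refl)))) (there (here refl)) (here refl)
        (a≁c abd) (a≁c abd′) (a≢c abd) (a≢c abd′) d≢d′)

    far-path-start : ∀ {ρ v c d a b e f} → Adj G ρ v → Adj G v c → Adj G c d → c ≢ ρ → d ∉ c ∷ v ∷ ρ ∷ [] →
      FarPath a b e f → Start ρ (d ∷ c ∷ v ∷ ρ ∷ [])
    far-path-start ρv vc cd c≢ρ d∉ (_ , abe , ef , a≁f , a≢f) = started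
      (attach (path₃ ρv vc c≢ρ abe) (here refl) cd d∉ ef
        (Adj⇒≢ H (Adj-sym H ef) ∷∉ (λ { refl → a≁f (a~b abe) }) ∷∉ a≢f ∘ ≡-sym ∷∉ ∉[]))
      refl (there (there (there (here refl))))
      (ready₃ (there (there (there (here refl)))) (there (here refl)) (here refl)
        (a≁c abe) a≁f (a≢c abe) a≢f (Adj⇒≢ H ef))

    module _ {a b c d e} (Z : Zigzag a b c d e) where
      open Zigzag Z

      private
        d-new : d ∉ c ∷ b ∷ a ∷ []
        d-new = Adj⇒≢ H (b~c adc) ∷∉ b≢d ∘ ≡-sym ∷∉ Adj⇒≢ H (Adj-sym H (a~b adc)) ∷∉ ∉[]

        e-new : e ∉ d ∷ c ∷ b ∷ a ∷ []
        e-new = Adj⇒≢ H (Adj-sym H (b~c ade)) ∷∉ a≢c cde ∘ ≡-sym ∷∉ (λ { refl → a≁c ade (a~b abc) })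
          ∷∉ a≢c ade ∘ ≡-sym ∷∉ ∉[]

      zigzag-start : ∀ {ρ v w x y} → Adj G ρ v → Adj G v w → Adj G w x → Adj G x y → w ≢ ρ → x ∉ w ∷ v ∷ ρ ∷ [] →
        y ∉ x ∷ w ∷ v ∷ ρ ∷ [] → Start ρ (y ∷ x ∷ w ∷ v ∷ ρ ∷ [])
      zigzag-start ρv vw wx xy w≢ρ x∉ y∉ = started
        (attach (attach (path₃ ρv vw w≢ρ abc) (here refl) wx x∉ (Adj-sym H (b~c adc)) d-new)
          (here refl) xy y∉ (b~c ade) e-new)
        refl (there (there (there (there (here refl)))))
        (ready₃ (there (there (there (there (here refl))))) (there (there (here refl))) (here refl)
          (a≁c adc) (a≁c ade) (a≢c adc) (a≢c ade) (a≢c cde))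

      -- Here x hangs from ρ instead of w, using the chord a - d. As a, c, e are independent, the
      -- images a of ρ and c of w are ready at the same time.
      zigzag-finish : ∀ {ρ v w x y} → Adj G ρ v → Adj G v w → Adj G ρ x → Adj G x y → w ≢ ρ → x ∉ w ∷ v ∷ ρ ∷ [] →
        y ∉ x ∷ w ∷ v ∷ ρ ∷ [] → (∀ t → t ∉ y ∷ x ∷ w ∷ v ∷ ρ ∷ [] → Adj G ρ t ⊎ Adj G w t) → Embedding G H
      zigzag-finish ρv vw ρx xy w≢ρ x∉ y∉ rest = finish
        (attach (attach (path₃ ρv vw w≢ρ abc) (there (there (here refl))) ρx x∉ (a~b adc) d-new)
          (here refl) xy y∉ (b~c ade) e-new)
        λ t t∉ → case rest t t∉ of λ where
          (inj₁ ρt) → _ , _ , there (there (there (there (here refl)))) , ρt ,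
            ready₃ (there (there (there (there (here refl))))) (there (there (here refl))) (here refl)
              (a≁c adc) (a≁c ade) (a≢c adc) (a≢c ade) (a≢c cde)
          (inj₂ wt) → _ , _ , there (there (here refl)) , wt ,
            ready₃ (there (there (here refl))) (there (there (there (there (here refl))))) (here refl)
              (a≁c adc ∘ Adj-sym H) (a≁c cde) (a≢c adc ∘ ≡-sym) (a≢c cde) (a≢c ade)

  AvoidingStart : Fin n → List (Fin n) → Set
  AvoidingStart ρ Z = ∃ λ ds → Start ρ ds × (∀ {z} → z ∈ Z → z ∉ ds)

  avoid : ∀ {Z ds : List (Fin n)} → All (_∉ Z) ds → ∀ {z} → z ∈ Z → z ∉ ds
  avoid ds∉Z z∈Z z∈ds = All.lookup ds∉Z z∈ds z∈Z

  stem-start : ∀ {ρ v c Z} → Irregular → Adj G ρ v → Adj G v c → c ≢ ρ → ρ ∉ Z → v ∉ Z → c ∉ Z → AvoidingStart ρ Z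
  stem-start irr ρv vc c≢ρ ρ∉ v∉ c∉ with irregular-start irr ρv vc c≢ρ
  ... | inj₁ s = _ , s , avoid (ρ∉ ∷ [])
  ... | inj₂ s = _ , s , avoid (c∉ ∷ v∉ ∷ ρ∉ ∷ [])

  shape-start : ∀ {ρ Z} → 6 ≤ n → Regular → ρ ∉ Z → Shape ρ Z → AvoidingStart ρ Z
  shape-start n≥6 reg ρ∉ (fork ρv vc vc′ c≢ρ c′≢ρ c≢c′ v∉ c∉ c′∉) =
    let _ , _ , _ , _ , φ = OnRegular.fork-exists reg n≥6 a₀∈K
    in _ , OnRegular.fork-start reg φ ρv vc vc′ c≢ρ c′≢ρ c≢c′ , avoid (c′∉ ∷ c∉ ∷ v∉ ∷ ρ∉ ∷ [])
  shape-start n≥6 reg ρ∉ (bifork ρv vc ρv′ v′c′ v≢v′ c≢c′ c∉N c′∉N v∉ c∉ v′∉ c′∉) =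
    let _ , _ , _ , _ , _ , φ = OnRegular.bifork-exists reg n≥6 a₀∈K
    in _ , OnRegular.bifork-start reg φ ρv vc ρv′ v′c′ v≢v′ c≢c′ c∉N c′∉N
         , avoid (c′∉ ∷ v′∉ ∷ c∉ ∷ v∉ ∷ ρ∉ ∷ [])
  shape-start {ρ} {Z} n≥6 reg ρ∉ (path ρv vc cd de c∉ d∉ e∉ v∉Z c∉Z d∉Z e∉Z) =
    by (OnRegular.far-path-or-zigzag reg (≤-trans (n≤1+n 5) n≥6) a₀∈K)
    where
    by : _ → AvoidingStart ρ Z
    by (inj₁ (_ , _ , _ , _ , φ)) =
      _ , OnRegular.far-path-start reg ρv vc cd (∉⇒≢ c∉ (there (here refl))) d∉ φ
        , avoid (d∉Z ∷ c∉Z ∷ v∉Z ∷ ρ∉ ∷ [])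
    by (inj₂ (_ , _ , _ , _ , _ , ζ)) =
      _ , OnRegular.zigzag-start reg ζ ρv vc cd de (∉⇒≢ c∉ (there (here refl))) d∉ e∉
        , avoid (e∉Z ∷ d∉Z ∷ c∉Z ∷ v∉Z ∷ ρ∉ ∷ [])

  leaf-pair-finish : ∀ {u x y} → Adj G u x → Adj G u y → x ≢ y →
    (∀ {w z} → w ∈ x ∷ y ∷ [] → Adj G w z → z ∈ x ∷ y ∷ [] ⊎ z ≡ u) →
    AvoidingStart u (x ∷ y ∷ []) → Embedding G H
  leaf-pair-finish {u} {x} {y} ux uy x≢y sealed (_ , started {L} P refl u∈ ready , avoids) =
    extend (spread mindeg (x ∷ y ∷ []) ((x≢y ∷∉ ∉[]) ∷ᵘ ∉[] ∷ᵘ []) refl P (∈-dom u∈) avoids sealed)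
    where
    extend : _ → Embedding G H
    extend (L′ , P′ , sub , _ , cover) = finish P′ λ t t∉ → case cover t of λ where
      (inj₁ t∈) → contradiction t∈ t∉
      (inj₂ (here refl)) → u , _ , sub u∈ , ux , room-⊆ sub ready
      (inj₂ (there (here refl))) → u , _ , sub u∈ , uy , room-⊆ sub ready

  -- L embeds everything but a pendant path v – u – x, and v is mapped to b.
  module PendantPath {u v x c d : Fin n} (uv : Adj G u v) (ux : Adj G u x) (x≢v : x ≢ v) (x-leaf : ∀ {z} → Adj G x z → z ≡ u)
    (sealed : ∀ {w z} → w ∈ u ∷ x ∷ [] → Adj G w z → z ∈ u ∷ x ∷ [] ⊎ z ≡ v)
    (vc : Adj G v c) (cd : Adj G c d) (d≢v : d ≢ v)
    {L : Pairs} (P : Partial L) {b : Fin N} (vb∈ : (v , b) ∈ L)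
    (avoids : ∀ {z} → z ∈ u ∷ x ∷ [] → z ∉ dom L) (cover : ∀ t → t ∈ dom L ⊎ t ∈ u ∷ x ∷ [])
    (c∈ : c ∈ dom L) (d∈ : d ∈ dom L) where

    u∉ : u ∉ dom L
    u∉ = avoids (here refl)

    x∉ : x ∉ dom L
    x∉ = avoids (there (here refl))

    x≢u : x ≢ u
    x≢u = Adj⇒≢ G (Adj-sym G ux)

    size : 2 + length L ≤ n
    size = subst (λ l → 2 + l ≤ n) (length-map proj₁ L)
      (unique-length ((x≢u ∘ ≡-sym ∷∉ u∉) ∷ᵘ x∉ ∷ᵘ Built-unique G (built P)))

    -- The obstacle to placing u at t: no free vertex would remain for x.
    Saturated : Fin N → Set
    Saturated t = Adj H b t × t ∉ cod L × (∀ {k} → Adj H t k → k ∈ cod L)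

    extend-through : ∀ t → Adj H b t → t ∉ cod L → Embedding G H ⊎ Saturated t
    extend-through t bt t∉ with any? (λ k → adj? H t k ×-dec ¬? (k ∈? (t ∷ cod L)))
    ... | no ¬p = inj₂ (bt , t∉ , λ {k} tk → decidable-stable (k ∈? cod L) λ k∉ →
      ¬p (k , tk , (Adj⇒≢ H (Adj-sym H tk) ∷∉ k∉)))
    ... | yes (k , tk , k∉) = inj₁ (embedding
      (isPartial (attach (attach P vb∈ (Adj-sym G uv) u∉ bt t∉) (here refl) ux (x≢u ∷∉ x∉) tk k∉))
      λ z → case cover z of λ where
        (inj₁ z∈) → there (there z∈)
        (inj₂ (here refl)) → there (here refl)
        (inj₂ (there (here refl))) → here refl)

    -- The at least n - 3 neighbours of t all lie among the at most n - 2 used vertices.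
    missed-unique : ∀ {t s s′} → Saturated t → s ∈ cod L → s′ ∈ cod L → ¬ Adj H t s → ¬ Adj H t s′ → s ≡ s′
    missed-unique {t} {s} {s′} (_ , _ , sat) s∈ s′∈ ts ts′ = decidable-stable (s ≟ s′) λ s≢s′ →
      <⇒≱ (≤-trans (s≤s (s≤s (s≤s (s≤s ≤-refl))))
            (≤-trans (s≤s (s≤s (2+deg≤L s≢s′))) size)) (mindeg t)
      where
      2+deg≤L : s ≢ s′ → 2 + length (nbrs H t) ≤ length L
      2+deg≤L s≢s′ = subst (2 + length (nbrs H t) ≤_) (length-map proj₂ L)
        (unique-⊆⇒length-≤ ((s≢s′ ∷∉ ts ∘ nbrs⁻ H) ∷ᵘ (ts′ ∘ nbrs⁻ H) ∷ᵘ nbrs-unique H t) λ where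
          (here refl) → s∈
          (there (here refl)) → s′∈
          (there (there k∈)) → sat (nbrs⁻ H k∈))

    module TwoSaturated {a t : Fin N} (a≢t : a ≢ t) (sat-a : Saturated a) (sat-t : Saturated t) where

      ba : Adj H b a
      ba = proj₁ sat-a
      bt : Adj H b t
      bt = proj₁ sat-t
      a∉ : a ∉ cod L
      a∉ = proj₁ (proj₂ sat-a)
      t∉ : t ∉ cod L
      t∉ = proj₁ (proj₂ sat-t)

      Swappable : Fin n × Fin N → Set
      Swappable (w , h) = w ≢ v × Adj H a h × All (λ (s , k) → Adj G w s → Adj H t k) L

      swappable? : ∀ p → Dec (Swappable p)
      swappable? (w , h) = ¬? (w ≟ v) ×-dec adj? H a h ×-dec
        All.all? (λ (s , k) → adj? G w s →-dec adj? H t k) L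

      -- Move w from h to t, which frees h for x, while u goes to a.
      swap : ∀ {w h} → (w , h) ∈ L → Swappable (w , h) → Embedding G H
      swap {w} {h} wh∈ (w≢v , ah , tN) = embedding M-partial M-total
        where
        off-w : ∀ p → Dec (proj₁ p ≢ w)
        off-w p = ¬? (proj₁ p ≟ w)
        L⁻ M : Pairs
        L⁻ = filter off-w L
        M = (x , h) ∷ (u , a) ∷ (w , t) ∷ L⁻
        L⁻⊆L : ∀ {p} → p ∈ L⁻ → p ∈ L
        L⁻⊆L p∈ = proj₁ (∈-filter⁻ off-w {xs = L} p∈)
        L⁻-off : ∀ {p} → p ∈ L⁻ → proj₁ p ≢ w
        L⁻-off p∈ = proj₂ (∈-filter⁻ off-w {xs = L} p∈)
        dom⁻ : ∀ {z} → z ∈ dom L⁻ → z ∈ dom L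
        dom⁻ z∈ = ∈-dom (L⁻⊆L (proj₂ (dom-entry z∈)))
        cod⁻ : ∀ {z} → z ∈ cod L⁻ → z ∈ cod L
        cod⁻ z∈ = ∈-cod (L⁻⊆L (proj₂ (cod-entry z∈)))
        w∈ : w ∈ dom L
        w∈ = ∈-dom wh∈
        h∈ : h ∈ cod L
        h∈ = ∈-cod wh∈
        w-hom : ∀ {s k} → (s , k) ∈ L⁻ → Adj G w s → Adj H t k
        w-hom sk∈ = All.lookup tN (L⁻⊆L sk∈)
        u-hom : ∀ {s k} → (s , k) ∈ (w , t) ∷ L⁻ → Adj G u s → Adj H a k
        u-hom (here refl) uw with sealed (here refl) uw
        ... | inj₁ w∈Z = contradiction w∈ (avoids w∈Z)
        ... | inj₂ w≡v = contradiction w≡v w≢v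
        u-hom (there sk∈) us with sealed (here refl) us
        ... | inj₁ s∈Z = contradiction (dom⁻ (∈-dom sk∈)) (avoids s∈Z)
        ... | inj₂ refl with functional (isPartial P) (L⁻⊆L sk∈) vb∈
        ... | refl = Adj-sym H ba
        x-hom : ∀ {s k} → (s , k) ∈ (u , a) ∷ (w , t) ∷ L⁻ → Adj G x s → Adj H h k
        x-hom (here refl) _ = Adj-sym H ah
        x-hom (there (here refl)) xw = contradiction (subst (_∈ dom L) (x-leaf xw) w∈) u∉
        x-hom (there (there sk∈)) xs = contradiction (subst (_∈ dom L) (x-leaf xs) (dom⁻ (∈-dom sk∈))) u∉
        M-partial : IsPartial M
        M-partial =
          partial-∷
            (partial-∷
              (partial-∷ (partial-⊆ L⁻⊆L (isPartial P))
                (λ w∈⁻ → L⁻-off (proj₂ (dom-entry w∈⁻)) refl) (t∉ ∘ cod⁻) w-hom)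
              (∉⇒≢ u∉ w∈ ∷∉ u∉ ∘ dom⁻) (a≢t ∷∉ a∉ ∘ cod⁻) u-hom)
            (x≢u ∷∉ ∉⇒≢ x∉ w∈ ∷∉ x∉ ∘ dom⁻)
            (∉⇒≢ a∉ h∈ ∘ ≡-sym ∷∉ ∉⇒≢ t∉ h∈ ∘ ≡-sym ∷∉ λ h∈⁻ →
              let _ , sh∈ = cod-entry h∈⁻ in L⁻-off sh∈ (injective (isPartial P) (L⁻⊆L sh∈) wh∈))
            x-hom
        M-total : ∀ z → z ∈ dom M
        M-total z with cover z
        ... | inj₂ (here refl) = there (here refl)
        ... | inj₂ (there (here refl)) = here refl
        ... | inj₁ z∈ with z ≟ w
        ... | yes refl = there (there (here refl))
        ... | no z≢w = there (there (there (∈-dom (∈-filter⁺ off-w (proj₂ (dom-entry z∈)) z≢w))))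

      module Stuck (stuck : ∀ {w h} → (w , h) ∈ L → ¬ Swappable (w , h)) where

        obstruction : ∀ {w h} → (w , h) ∈ L → w ≢ v → Adj H a h → ∃ λ s → ∃ λ k → (s , k) ∈ L × Adj G w s × ¬ Adj H t k
        obstruction {w} {h} wh∈ w≢v ah
          with find (¬All⇒Any¬ (λ (s , k) → adj? G w s →-dec adj? H t k) L λ all → stuck wh∈ (w≢v , ah , all))
        ... | (s , k) , sk∈ , ¬imp = s , k , sk∈
          , decidable-stable (adj? G w s) (λ ws → ¬imp λ ws′ → contradiction ws′ ws)
          , λ tk → ¬imp λ _ → tk

        c≢v : c ≢ v
        c≢v = Adj⇒≢ G (Adj-sym G vc)

        Missed : Set
        Missed = ∃ λ μ → ∃ λ z → (μ , z) ∈ L × ¬ Adj H t z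

        -- Since a misses at most one used vertex, it is adjacent to the image of c or of d, and
        -- there `obstruction` applies.
        missed : ∀ {hc hd} → (c , hc) ∈ L → (d , hd) ∈ L → Missed
        missed {hc} {hd} chc∈ dhd∈ with adj? H a hc | adj? H a hd
        ... | yes ahc | _ = let μ , z , μz∈ , _ , tz = obstruction chc∈ c≢v ahc in μ , z , μz∈ , tz
        ... | no _ | yes ahd = let μ , z , μz∈ , _ , tz = obstruction dhd∈ d≢v ahd in μ , z , μz∈ , tz
        ... | no ¬ahc | no ¬ahd with missed-unique sat-a (∈-cod chc∈) (∈-cod dhd∈) ¬ahc ¬ahd
        ... | refl = contradiction (injective (isPartial P) chc∈ dhd∈) (Adj⇒≢ G cd)

        module Centre {μ z} (μz∈ : (μ , z) ∈ L) (t≁z : ¬ Adj H t z) where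

          only-μ : ∀ {s k} → (s , k) ∈ L → ¬ Adj H t k → s ≡ μ
          only-μ sk∈ tk with missed-unique sat-t (∈-cod sk∈) (∈-cod μz∈) tk t≁z
          ... | refl = injective (isPartial P) sk∈ μz∈

          v≢μ : v ≢ μ
          v≢μ refl with functional (isPartial P) vb∈ μz∈
          ... | refl = t≁z (Adj-sym H bt)

          -- Otherwise μ would be obstructed by a tree neighbour whose image t misses, which can
          -- only be μ.
          a≁z : ¬ Adj H a z
          a≁z az with obstruction μz∈ (v≢μ ∘ ≡-sym) az
          ... | _ , _ , sk∈ , μs , tk with only-μ sk∈ tk
          ... | refl = Adj-irrefl G μs

          -- As z is also the only used vertex that a misses, a is adjacent to the image of s; the
          -- obstruction at s must then be μ.
          centre : ∀ {s} → s ∈ dom L → s ≢ v → s ≢ μ → Adj G s μ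
          centre {s} s∈ s≢v s≢μ = from (dom-entry s∈)
            where
            from : ∃ (λ k → (s , k) ∈ L) → Adj G s μ
            from (k , sk∈) with adj? H a k
            ... | no ¬ak with missed-unique sat-a (∈-cod sk∈) (∈-cod μz∈) ¬ak a≁z
            ... | refl = contradiction (injective (isPartial P) sk∈ μz∈) s≢μ
            from (k , sk∈) | yes ak with obstruction sk∈ s≢v ak
            ... | _ , _ , s′k′∈ , ss′ , tk′ with only-μ s′k′∈ tk′
            ... | refl = ss′

          -- The path u - v - μ would be the spine of an excluded tree, with x at u and all other
          -- vertices at μ.
          not-adjacent : ¬ Adj G v μ
          not-adjacent vμ = not-T p q (p≥1 ux x≢v) μ-leaf p+q+3≡n iso
            where
            spine-or-leaf : ∀ s → s ∉ u ∷ v ∷ μ ∷ [] → Adj G u s ⊎ Adj G μ s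
            spine-or-leaf s s∉ with cover s
            ... | inj₁ s∈ = inj₂ (Adj-sym G (centre s∈ (∉⇒≢ s∉ (there (here refl))) (∉⇒≢ s∉ (there (there (here refl))))))
            ... | inj₂ (here refl) = contradiction (here refl) s∉
            ... | inj₂ (there (here refl)) = inj₁ ux
            open Recognise G tree uv vμ (∉⇒≢ u∉ (∈-dom μz∈)) spine-or-leaf
            μ-leaf : 1 ≤ q
            μ-leaf with c ≟ μ
            ... | yes refl = q≥1 cd d≢v
            ... | no c≢μ = q≥1 (Adj-sym G (centre c∈ c≢v c≢μ)) c≢v

          -- The tree is the path x – u – v – c – μ with further leaves at μ.
          rotate : ∀ {hc} → (c , hc) ∈ L → Embedding G H
          -- The path μ - c - v - u - x is sent to a - b - t - hc - z. The image a of μ misses t and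
          -- z, so it is ready for the other leaves.
          rotate {hc} chc∈ = finish
            (attach (attach (attach (attach (start μ a)
              (here refl) μc (c≢μ ∷∉ ∉[]) (Adj-sym H ba) (∉⇒≢ a∉ b∈ ∘ ≡-sym ∷∉ ∉[]))
              (here refl) (Adj-sym G vc) (c≢v ∘ ≡-sym ∷∉ v≢μ ∷∉ ∉[]) bt (∉⇒≢ t∉ b∈ ∷∉ a≢t ∘ ≡-sym ∷∉ ∉[]))
              (here refl) (Adj-sym G uv) (off u∉) thc
                (∉⇒≢ t∉ hc∈ ∘ ≡-sym ∷∉ hc≢b ∷∉ ∉⇒≢ a∉ hc∈ ∘ ≡-sym ∷∉ ∉[]))
              (here refl) ux (x≢u ∷∉ off x∉) hcz
                (z≢hc ∷∉ ∉⇒≢ t∉ z∈ ∘ ≡-sym ∷∉ z≢b ∷∉ ∉⇒≢ a∉ z∈ ∘ ≡-sym ∷∉ ∉[]))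
            λ s s∉ → case cover s of λ where
              (inj₁ s∈) → μ , a , there (there (there (there (here refl))))
                , Adj-sym G (centre s∈ (λ { refl → s∉ (there (there (here refl))) })
                    (λ { refl → s∉ (there (there (there (there (here refl))))) }))
                , ready₃ (there (there (there (there (here refl))))) (there (there (here refl))) (here refl)
                    (λ at → t∉ (proj₂ (proj₂ sat-a) at)) a≁z a≢t (∉⇒≢ a∉ z∈) (∉⇒≢ t∉ z∈)
              (inj₂ (here refl)) → contradiction (there (here refl)) s∉
              (inj₂ (there (here refl))) → contradiction (here refl) s∉
            where
            b∈ : b ∈ cod L
            b∈ = ∈-cod vb∈
            hc∈ : hc ∈ cod L
            hc∈ = ∈-cod chc∈
            z∈ : z ∈ cod L
            z∈ = ∈-cod μz∈
            c≢μ : c ≢ μ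
            c≢μ refl = not-adjacent vc
            μc : Adj G μ c
            μc = Adj-sym G (centre c∈ c≢v c≢μ)
            off : ∀ {s} → s ∉ dom L → s ∉ v ∷ c ∷ μ ∷ []
            off s∉ = ∉⇒≢ s∉ (∈-dom vb∈) ∷∉ ∉⇒≢ s∉ c∈ ∷∉ ∉⇒≢ s∉ (∈-dom μz∈) ∷∉ ∉[]
            thc : Adj H t hc
            thc = decidable-stable (adj? H t hc) (c≢μ ∘ only-μ chc∈)
            hcz : Adj H hc z
            hcz = preserves (isPartial P) chc∈ μz∈ (Adj-sym G μc)
            hc≢b : hc ≢ b
            hc≢b refl = c≢v (injective (isPartial P) chc∈ vb∈)
            z≢hc : z ≢ hc
            z≢hc = Adj⇒≢ H (Adj-sym H hcz)
            z≢b : z ≢ b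
            z≢b refl = v≢μ (injective (isPartial P) vb∈ μz∈)

        embed : Embedding G H
        embed =
          let _ , chc∈ = dom-entry c∈
              _ , _ , μz∈ , t≁z = missed chc∈ (proj₂ (dom-entry d∈))
          in Centre.rotate μz∈ t≁z chc∈

      embed : Embedding G H
      embed with Any.any? swappable? L
      ... | yes any = let _ , wh∈ , sw = find any in swap wh∈ sw
      ... | no ¬any = Stuck.embed λ wh∈ sw → ¬any (Any.map (λ { refl → sw }) wh∈)

    -- Two tree vertices are missing, so readiness yields two different free neighbours of b to try
    -- as the image of u. If both are saturated, the exchange argument applies.
    complete : Ready b L → Embedding G H
    complete ready =
      let t₁ , bt₁ , t₁∉ = free-neighbour ready (length-dom-< P u∉)
          P₁ = attach P vb∈ (Adj-sym G uv) u∉ bt₁ t₁∉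
          t₂ , bt₂ , t₂∉ = free-neighbour (room-⊆ {L′ = (u , t₁) ∷ L} there ready) (length-dom-< P₁ (x≢u ∷∉ x∉))
      in combine (t₂∉ ∘ here ∘ ≡-sym) (extend-through t₁ bt₁ t₁∉) (extend-through t₂ bt₂ (t₂∉ ∘ there))
      where
      combine : ∀ {t₁ t₂} → t₁ ≢ t₂ → Embedding G H ⊎ Saturated t₁ → Embedding G H ⊎ Saturated t₂ → Embedding G H
      combine t₁≢t₂ (inj₁ e) _ = e
      combine t₁≢t₂ (inj₂ _) (inj₁ e) = e
      combine t₁≢t₂ (inj₂ s₁) (inj₂ s₂) = TwoSaturated.embed t₁≢t₂ s₁ s₂

  -- Trees with two leaves at one vertex

  module TwinLeaves {u x y : Fin n} (ux : Adj G u x) (uy : Adj G u y) (x≢y : x ≢ y)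
    (leaf : ∀ {w z} → w ∈ x ∷ y ∷ [] → Adj G w z → z ≡ u) where

    Z : List (Fin n)
    Z = x ∷ y ∷ []

    sealed : ∀ {w z} → w ∈ Z → Adj G w z → z ∈ Z ⊎ z ≡ u
    sealed w∈ wz = inj₂ (leaf w∈ wz)

    open Rooted sealed

    u∉Z : u ∉ Z
    u∉Z = Adj⇒≢ G ux ∷∉ Adj⇒≢ G uy ∷∉ ∉[]

    Z⊆nbrs : ∀ {z} → z ∈ Z → z ∈ nbrs G u
    Z⊆nbrs (here refl) = nbrs⁺ G ux
    Z⊆nbrs (there (here refl)) = nbrs⁺ G uy

    U₀⊆ : ∀ {z} → z ∈ U₀ → z ∈ u ∷ nbrs G u
    U₀⊆ z∈ with ∈-++⁻ Z z∈
    ... | inj₁ z∈Z = there (Z⊆nbrs z∈Z)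
    ... | inj₂ z∈N = z∈N

    module _ (s : Stem) where
      open Stem s

      n≥6 : 6 ≤ n
      -- The vertex u has the three neighbours v, x, y and degree at most n - 3.
      n≥6 = ≤-trans (+-monoʳ-≤ 3 (unique-⊆⇒length-≤ {xs = v ∷ Z} (v∉Z ∷ᵘ (x≢y ∷∉ ∉[]) ∷ᵘ ∉[] ∷ᵘ []) λ where
        (here refl) → nbrs⁺ G ρv
        (there z∈) → Z⊆nbrs z∈)) (maxdeg u)

      -- The third outcome of `explore` would give the excluded tree with spine u - v - c.
      not-T-shaped : ∀ {d} → Adj G c d → d ∉ c ∷ U₀ → ¬ (∀ z → z ∈ c ∷ nbrs G c ++ U₀)
      not-T-shaped cd d∉ full = not-T p q (p≥1 ux (∉⇒≢ v∉Z (here refl) ∘ ≡-sym))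
        (q≥1 cd (∉⇒≢ d∉ (there (∈-++⁺ʳ Z (there (nbrs⁺ G ρv)))))) p+q+3≡n iso
        where
        cover : ∀ z → z ∉ u ∷ v ∷ c ∷ [] → Adj G u z ⊎ Adj G c z
        cover z z∉ with full z
        ... | here refl = contradiction (there (there (here refl))) z∉
        ... | there z∈ with ∈-++⁻ (nbrs G c) z∈
        ... | inj₁ z∈N = inj₂ (nbrs⁻ G z∈N)
        ... | inj₂ z∈U₀ with U₀⊆ z∈U₀
        ... | here refl = contradiction (here refl) z∉
        ... | there z∈N = inj₁ (nbrs⁻ G z∈N)
        open Recognise G tree ρv vc (c≢ρ ∘ ≡-sym) cover

      shape : Shape u Z
      shape with explore s
      ... | inj₁ σ = σ
      ... | inj₂ (inj₂ (_ , cd , d∉ , full)) = contradiction full (not-T-shaped cd d∉)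
      -- By the degree bound, N[u] and c together have at most n - 1 vertices.
      ... | inj₂ (inj₁ full) with missing (c ∷ u ∷ nbrs G u) (maxdeg u)
      ... | z , z∉ with full z
      ... | here z≡c = contradiction (here z≡c) z∉
      ... | there z∈ = contradiction (there (U₀⊆ z∈)) z∉

      start-at-u : Irregular ⊎ Regular → AvoidingStart u Z
      start-at-u (inj₁ irr) = stem-start irr ρv vc c≢ρ u∉Z v∉Z c∉Z
      start-at-u (inj₂ reg) = shape-start n≥6 reg u∉Z shape

    embed : Embedding G H
    embed =
      let z , z∉ = missing (u ∷ nbrs G u) (≤-trans (n≤1+n _) (maxdeg u))
      in leaf-pair-finish ux uy x≢y sealed (start-at-u (stem (z , z∉ ∘ U₀⊆)) regular?)

  -- Trees with a pendant path of two edges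

  module PendantEdge {u v x : Fin n} (uv : Adj G u v) (ux : Adj G u x) (x≢v : x ≢ v)
    (x-leaf : ∀ {z} → Adj G x z → z ≡ u) (u-nbrs : ∀ {z} → Adj G u z → z ≡ v ⊎ z ≡ x) where

    Z : List (Fin n)
    Z = u ∷ x ∷ []

    sealed : ∀ {w z} → w ∈ Z → Adj G w z → z ∈ Z ⊎ z ≡ v
    sealed (here refl) uz with u-nbrs uz
    ... | inj₁ z≡v = inj₂ z≡v
    ... | inj₂ z≡x = inj₁ (there (here z≡x))
    sealed (there (here refl)) xz = inj₁ (here (x-leaf xz))

    open Rooted sealed

    v∉Z : v ∉ Z
    v∉Z = Adj⇒≢ G (Adj-sym G uv) ∷∉ x≢v ∘ ≡-sym ∷∉ ∉[]

    x∉N[v] : x ∉ v ∷ nbrs G v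
    x∉N[v] = x≢v ∷∉ λ x∈ → Adj⇒≢ G (Adj-sym G uv) (x-leaf (Adj-sym G (nbrs⁻ G x∈)))

    U₀⊆ : ∀ {z} → z ∈ U₀ → z ∈ x ∷ v ∷ nbrs G v
    U₀⊆ (here refl) = there (there (nbrs⁺ G (Adj-sym G uv)))
    U₀⊆ (there (here refl)) = here refl
    U₀⊆ (there (there z∈)) = there z∈

    module _ (s : Stem) where
      open Stem s renaming (v to c; c to d; ρv to vc; vc to cd; v∉Z to c∉Z; c∉U₀ to d∉U₀; c≢ρ to d≢v; c∉Z to d∉Z)

      c≢u : c ≢ u
      c≢u = ∉⇒≢ c∉Z (here refl)

      -- On the five vertices of the path x - u - v - c - d alone, the tree would be the excluded
      -- T(1,1).
      n≥6 : 6 ≤ n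
      n≥6 with full? (u ∷ v ∷ c ∷ x ∷ d ∷ [])
      ... | inj₂ (z , z∉) = unique-length (z∉
        ∷ᵘ (Adj⇒≢ G uv ∷∉ c≢u ∘ ≡-sym ∷∉ Adj⇒≢ G ux ∷∉ ∉⇒≢ d∉Z (here refl) ∘ ≡-sym ∷∉ ∉[])
        ∷ᵘ (Adj⇒≢ G vc ∷∉ x≢v ∘ ≡-sym ∷∉ d≢v ∘ ≡-sym ∷∉ ∉[])
        ∷ᵘ (∉⇒≢ c∉Z (there (here refl)) ∷∉ Adj⇒≢ G cd ∷∉ ∉[])
        ∷ᵘ (∉⇒≢ d∉Z (there (here refl)) ∘ ≡-sym ∷∉ ∉[]) ∷ᵘ ∉[] ∷ᵘ [])
      ... | inj₁ full = contradiction iso (not-T p q (p≥1 ux x≢v) (q≥1 cd d≢v) p+q+3≡n)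
        where
        cover : ∀ z → z ∉ u ∷ v ∷ c ∷ [] → Adj G u z ⊎ Adj G c z
        cover z z∉ with full z
        ... | here z≡u = contradiction (here z≡u) z∉
        ... | there (here z≡v) = contradiction (there (here z≡v)) z∉
        ... | there (there (here z≡c)) = contradiction (there (there (here z≡c))) z∉
        ... | there (there (there (here refl))) = inj₁ ux
        ... | there (there (there (there (here refl)))) = inj₂ cd
        open Recognise G tree uv vc (c≢u ∘ ≡-sym) cover

      from-start : AvoidingStart v Z → Embedding G H
      from-start (_ , started {L} {b} P refl v∈ ready , avoids) =
        extend (spread mindeg Z ((Adj⇒≢ G ux ∷∉ ∉[]) ∷ᵘ ∉[] ∷ᵘ []) refl P (∈-dom v∈) avoids sealed)
        where
        extend : _ → Embedding G H
        extend (L′ , P′ , sub , avoids′ , cover) =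
          PendantPath.complete uv ux x≢v x-leaf sealed vc cd d≢v P′ (sub v∈) avoids′ cover
            (covered c∉Z) (covered d∉Z) (room-⊆ sub ready)
          where
          covered : ∀ {z} → z ∉ Z → z ∈ dom L′
          covered {z} z∉ with cover z
          ... | inj₁ z∈ = z∈
          ... | inj₂ z∈Z = contradiction z∈Z z∉

      -- Two legs v - u - x and v - c - d fill a bifork, and every other vertex is adjacent to v,
      -- whose image is ready.
      spider : Regular → (∀ z → z ∈ d ∷ U₀) → Embedding G H
      spider reg full =
        let _ , _ , _ , _ , _ , φ = OnRegular.bifork-exists reg n≥6 a₀∈K
        in from (OnRegular.bifork-start reg φ (Adj-sym G uv) ux vc cd (c≢u ∘ ≡-sym)
             (∉⇒≢ d∉Z (there (here refl)) ∘ ≡-sym) x∉N[v] (d∉U₀ ∘ ∈-++⁺ʳ Z))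
        where
        from : Start v (d ∷ c ∷ x ∷ u ∷ v ∷ []) → Embedding G H
        from (started {L} {b} P eq v∈ ready) = finish P λ t t∉ →
          v , b , v∈ , v-adjacent t (t∉ ∘ subst (t ∈_) (≡-sym eq)) , ready
          where
          v-adjacent : ∀ t → t ∉ d ∷ c ∷ x ∷ u ∷ v ∷ [] → Adj G v t
          v-adjacent t t∉ with full t
          ... | here t≡d = contradiction (here t≡d) t∉
          ... | there t∈ with U₀⊆ t∈
          ... | here t≡x = contradiction (there (there (here t≡x))) t∉
          ... | there (here t≡v) = contradiction (there (there (there (there (here t≡v))))) t∉
          ... | there (there t∈N) = nbrs⁻ G t∈N

      -- A far path takes v - c - d - e, and u, x are added last. A zigzag takes v - c - d together
      -- with v - u - x; all remaining vertices then hang from v or d, both with ready images.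
      broom : Regular → ∀ {e} → Adj G d e → e ∉ d ∷ U₀ → (∀ z → z ∈ d ∷ nbrs G d ++ U₀) → Embedding G H
      broom reg {e} de e∉ full = from (OnRegular.far-path-or-zigzag reg (≤-trans (n≤1+n 5) n≥6) a₀∈K)
        where
        ∉c,v : ∀ {z} → z ∉ U₀ → z ∉ c ∷ v ∷ []
        ∉c,v z∉ = ∉⇒≢ z∉ (∈-++⁺ʳ Z (there (nbrs⁺ G vc))) ∷∉ ∉⇒≢ z∉ ρ∈U₀ ∷∉ ∉[]
        rest : ∀ t → t ∉ x ∷ u ∷ d ∷ c ∷ v ∷ [] → Adj G v t ⊎ Adj G d t
        rest t t∉ with full t
        ... | here t≡d = contradiction (there (there (here t≡d))) t∉
        ... | there t∈ with ∈-++⁻ (nbrs G d) t∈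
        ... | inj₁ t∈N = inj₂ (nbrs⁻ G t∈N)
        ... | inj₂ t∈U₀ with U₀⊆ t∈U₀
        ... | here t≡x = contradiction (here t≡x) t∉
        ... | there (here t≡v) = contradiction (there (there (there (there (here t≡v))))) t∉
        ... | there (there t∈N) = inj₁ (nbrs⁻ G t∈N)
        from : _ → Embedding G H
        from (inj₁ (_ , _ , _ , _ , φ)) = from-start
          (_ , OnRegular.far-path-start reg vc cd de d≢v (∉⇒≢ e∉ (here refl) ∷∉ ∉c,v (e∉ ∘ there)) φ
             , avoid (e∉ ∘ there ∘ ∈-++⁺ˡ ∷ d∉Z ∷ c∉Z ∷ v∉Z ∷ []))
        from (inj₂ (_ , _ , _ , _ , _ , ζ)) = OnRegular.zigzag-finish reg ζ vc cd (Adj-sym G uv) ux d≢v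
          (∉⇒≢ d∉Z (here refl) ∘ ≡-sym ∷∉ c≢u ∘ ≡-sym ∷∉ Adj⇒≢ G uv ∷∉ ∉[])
          (Adj⇒≢ G (Adj-sym G ux) ∷∉ ∉⇒≢ d∉Z (there (here refl)) ∘ ≡-sym ∷∉
            ∉⇒≢ c∉Z (there (here refl)) ∘ ≡-sym ∷∉ x≢v ∷∉ ∉[]) rest

      embed-from-stem : Irregular ⊎ Regular → Embedding G H
      embed-from-stem (inj₁ irr) = from-start (stem-start irr vc cd d≢v v∉Z c∉Z d∉Z)
      embed-from-stem (inj₂ reg) with explore s
      ... | inj₁ σ = from-start (shape-start n≥6 reg v∉Z σ)
      ... | inj₂ (inj₁ full) = spider reg full
      ... | inj₂ (inj₂ (_ , de , e∉ , full)) = broom reg de e∉ full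

    embed : Embedding G H
    embed =
      let z , z∉ = missing (x ∷ v ∷ nbrs G v) (maxdeg v)
      in embed-from-stem (stem (z , z∉ ∘ U₀⊆)) regular?

  -- A third neighbour y of u is a leaf like x. Without one, u has degree two and v - u - x is a
  -- pendant path.
  tree-embeds : 3 ≤ n → Embedding G H
  tree-embeds n≥3 with penultimate n≥3
  ... | u , v , x , pen with any? (λ y → adj? G u y ×-dec ¬? (y ≟ v) ×-dec ¬? (y ≟ x))
  ... | yes (y , uy , y≢v , y≢x) = TwinLeaves.embed ux uy (y≢x ∘ ≡-sym) λ where
      (here refl) → leaf ux x≢v
      (there (here refl)) → leaf uy y≢v
    where open Penultimate pen
  ... | no ¬p = PendantEdge.embed uv ux x≢v (leaf ux x≢v) λ {z} uz → case z ≟ v of λ where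
      (yes z≡v) → inj₁ z≡v
      (no z≢v) → inj₂ (decidable-stable (z ≟ x) λ z≢x → ¬p (z , uz , z≢v , z≢x))
    where open Penultimate pen

-- From colourings to embeddings in the red graph

theorem1p4 : (m n : ℕ) → 1 ≤ m → 1 ≤ n →
    (Tn : Graph n) → IsTree Tn →
    (∀ v → deg Tn v + 3 ≤ n) →
    (∀ (p q : ℕ) → 1 ≤ p → 1 ≤ q → p + q + 3 ≡ n → ¬ Iso Tn (T p q)) →
    ¬ LinComb2 (m + n ∸ 3) (n ∸ 1) (n ∸ 2) →
    RamseyLE Tn (star m) (m + n ∸ 3)
theorem1p4 m n 1≤m 1≤n Tn tree Δ not-T not-lincomb χ
  with any? (λ v → m + suc (length (nbrs (redGraph χ) v)) ≤? m + n ∸ 3)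
... | yes (v , le) = inj₂ (blue-star χ m v le)
... | no ¬star = inj₁ (from (large-component H mindeg))
  where
  H = redGraph χ
  maxdeg : ∀ v → 3 + length (nbrs Tn v) ≤ n
  maxdeg v = subst (_≤ n) (trans (+-comm _ 3) (cong (3 +_) (deg≡length-nbrs Tn v))) (Δ v)
  mindeg : ∀ h → n ≤ 3 + length (nbrs H h)
  -- Without a blue star, m + n ∸ 3 is at most m plus the red degree of h; adding 3 back gives at
  -- least m + n even if the subtraction is truncated.
  mindeg h = +-cancelˡ-≤ m n _ (begin
    m + n                                      ≤⟨ m≤n+m∸n (m + n) 3 ⟩
    3 + (m + n ∸ 3)                            ≤⟨ +-monoʳ-≤ 3 (s≤s⁻¹ (≰⇒> λ le → ¬star (h , subst (_≤ m + n ∸ 3) (≡-sym (+-suc m _)) le))) ⟩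
    3 + (m + length (nbrs H h))                ≡⟨ +-assoc 3 m _ ⟨
    (3 + m) + length (nbrs H h)                ≡⟨ cong (_+ length (nbrs H h)) (+-comm 3 m) ⟩
    (m + 3) + length (nbrs H h)                ≡⟨ +-assoc m 3 _ ⟩
    m + (3 + length (nbrs H h))                ∎)
    where open ≤-Reasoning
  n≥3 : 3 ≤ n
  n≥3 = ≤-trans (m≤m+n 3 _) (maxdeg (fromℕ< 1≤n))
  red-copy : Embedding Tn H → Copy red Tn χ
  red-copy (f , inj , hom) = f , inj , λ _ _ ij → redGraph⇒red χ (hom ij)
  from : _ → Copy red Tn χ
  from (inj₂ lincomb) = contradiction lincomb not-lincomb
  from (inj₁ (K , b , closed , n≤K)) =
    let _ , a₀∈K , _ = pigeonhole {ys = []} (Built-unique H b) (≤-trans (≤-trans (s≤s z≤n) n≥3) n≤K)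
    in red-copy (EmbedTree.tree-embeds Tn tree maxdeg not-T H mindeg K (closed-step H closed) (Built-big H b n≤K) a₀∈K n≥3)
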